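{- Let $S$ be a metric signature, let $L$ be a countable continuous fragment of $\mathcal{L}_{\omega_1,\omega}(S)$, and let $T$ be a satisfiable $L$-theory. For each $n<\omega$ let $\Sigma_n$ be a type of $T$ (in finitely many variables) that is not metrically principal over $T$. Then there is $\mathcal{M}\models T$ such that $\mathcal{M}$ is based on a complete metric space and $\mathcal{M}$ omits each $\Sigma_n$, i.e. no tuple of elements of $\mathcal{M}$ realizes any $\Sigma_n$.
   Context: Metric structures. A metric structure $\mathcal{M}$ consists of a metric space $(M,d)$ with $d\le 1$ (not necessarily complete; $\mathcal M$ is said to be based on $(M,d)$), together with sets of uniformly continuous functions $M^n\to M$, of uniformly continuous predicates $M^n\to[0,1]$, and of distinguished elements; $M^n$ carries the sup metric. A metric signature $S$ consists of function symbols and predicate symbols, each with an arity and a modulus of continuity $\delta:\mathbb{Q}\cap(0,1)\to\mathbb{Q}\cap(0,1)$, and constant symbols. An $S$-structure interprets each symbol respecting its modulus: $\sup_i d(a_i,b_i)<\delta(\epsilon)$ implies $d(f(\bar a),f(\bar b))\le\epsilon$ for function symbols, resp. $|P(\bar a)-P(\bar b)|\le\epsilon$ for predicate symbols. Formulas. Terms are as in first-order logic. Atomic formulas: $d(t_1,t_2)$ and $P(t_1,\dots,t_n)$ for terms $t_i$. Formulas of $\mathcal{L}_{\omega_1,\omega}(S)$ are built from atomic formulas and constants $q\in\mathbb{Q}\cap[0,1]$ by $\varphi\to\psi$, by $\sup_x\varphi$, and by $\sup_{n<\omega}\varphi_n$ when the total number of free variables in all $\varphi_n$ is finite. Truth values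 $\varphi^{\mathcal{M}}(\bar a)\in[0,1]$ are defined by recursion: atomic formulas and constants in the obvious way, $(\psi\to\theta)^{\mathcal M}=\min\{1-\psi^{\mathcal M}+\theta^{\mathcal M},1\}$, and $\sup_{n}$, $\sup_x$ are suprema over $n<\omega$ and over $x\in M$. $\mathcal{M}\models\varphi(\bar a)$ means $\varphi^{\mathcal M}(\bar a)=1$. Abbreviations: $\neg\varphi=(\varphi\to 0)$, with value $1-\varphi$; $\varphi\vee\psi=((\varphi\to\psi)\to\psi)$, the maximum; $\varphi\wedge\psi=\neg(\neg\varphi\vee\neg\psi)$, the minimum. For rational $r$, "$\varphi\ge r$" is the formula $r\to\varphi$ and "$\varphi\le r$" is the formula $\varphi\to r$. Fragments. A fragment of $\mathcal{L}_{\omega_1,\omega}(S)$ is a set $L$ of $\mathcal{L}_{\omega_1,\omega}(S)$-formulas that contains every atomic formula and every constant formula $q\in\mathbb{Q}\cap[0,1]$, is closed under $\sup_x$, $\to$ and $\neg$, and is closed under substituting terms for variables. It is continuous if for every $L$-formula $\varphi(x_1,\dots,x_n)$ and every $S$-structure $\mathcal{M}$, the function $M^n\to[0,1]$, $\bar a\mapsto\varphi^{\mathcal M}(\bar a)$, is continuous. An $L$-theory is a set of $L$-sentences; it is satisfiable if it has a model (an $S$-structure satisfying all its sentences). Types. A set $\Sigma(x_1,\dots,x_n)$ of $L$-formulas is a type of $T$ if it is realized in some model of $T$: there are $\mathcal{M}\models T$ and $\bar a\in M^n$ with $\mathcal{M}\models\varphi(\bar a)$ for all $\varphi\in\Sigma$.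 A type $\Sigma(x_1,\dots,x_n)$ of $T$ is principal over $T$ if there are an $L$-formula $\varphi(\bar y)$, terms $t_1(\bar y),\dots,t_n(\bar y)$ (with $\bar y$ a finite tuple of variables) and $r\in\mathbb{Q}\cap(0,1)$ such that (i) there are $\mathcal M\models T$ and $\bar b$ in $M$ with $\varphi^{\mathcal M}(\bar b)=1$; and (ii) for all $\mathcal{M}\models T$ and $\bar b$ in $M$ with $\varphi^{\mathcal M}(\bar b)\ge r$, the tuple $(t_1^{\mathcal M}(\bar b),\dots,t_n^{\mathcal M}(\bar b))$ realizes $\Sigma$. For $\delta\in\mathbb{Q}\cap(0,1)$ put $$\Sigma^\delta=\Big\{\sup_{y_1}\cdots\sup_{y_n}\Big(\bigwedge_{k\le n}d(x_k,y_k)\le\delta\ \wedge\ \sigma(y_1,\dots,y_n)\Big):\sigma\in\Sigma\Big\}.$$ A type $\Sigma$ of $T$ is metrically principal over $T$ if for every $\delta\in\mathbb{Q}\cap(0,1)$ the type $\Sigma^\delta$ is principal over $T$.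
   Formalization: The fragment L is additionally required to be closed under subformulas (the usual meaning of "fragment"); without this the statement fails, e.g. for L generated by the sentence sup_n inf_{m≥n} P_m(c) with Σ_n = {P_m(c) : m ≥ n}. -}

module Defs where

open import Data.Nat.Base as ℕ using (ℕ; zero; suc)
open import Data.Fin.Base using (Fin; zero; suc; _↑ˡ_; _↑ʳ_)
open import Data.List.Base using (foldr; map; allFin)
open import Data.Vec.Base using (Vec; []; _∷_; lookup; tabulate)
open import Data.Product.Base using (∃; ∃-syntax; Σ-syntax; _×_; _,_; proj₂)
open import Data.Sum.Base using (_⊎_; inj₁; inj₂)
open import Data.Rational.Base as ℚ using (ℚ; 0ℚ; 1ℚ)
import Data.Rational.Properties as ℚₚ
open import Data.Rational.Solver using (module +-*-Solver)
open import Function.Metric.Structures using (IsGeneralMetric)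
open import Level using (0ℓ)
open import Relation.Binary.Definitions using (tri<; tri≈; tri>)
open import Relation.Binary.PropositionalEquality using (_≡_; refl; sym; subst; subst₂)
open import Relation.Nullary using (¬_; contradiction)
open import Relation.Unary using (Pred; _∈_; _∉_; _⊆_)

------------------------------------------------------------------------
-- Real numbers, as (one-sided) Dedekind cuts

-- A real is the set of rationals strictly below it.  In the presence of
-- excluded middle these are exactly the classical real numbers.

record ℝ : Set₁ where
  field
    lower     : Pred ℚ 0ℓ
    inhabited : ∃[ q ] q ∈ lower
    bounded   : ∃[ q ] q ∉ lower
    downward  : ∀ {p q} → p ℚ.< q → q ∈ lower → p ∈ lower
    rounded   : ∀ {p} → p ∈ lower → ∃[ q ] p ℚ.< q × q ∈ lower

open ℝ public

infix 4 _≤_ _<_ _≃_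

_≤_ _<_ _≃_ : ℝ → ℝ → Set
x ≤ y = lower x ⊆ lower y
x < y = ∃[ q ] q ∈ lower y × q ∉ lower x
x ≃ y = x ≤ y × y ≤ x

private
  <-of-∉ : ∀ (x : ℝ) {p q} → p ∈ lower x → q ∉ lower x → p ℚ.< q
  <-of-∉ x {p} {q} p∈ q∉ with ℚₚ.<-cmp p q
  ... | tri< p<q _ _  = p<q
  ... | tri≈ _ refl _ = contradiction p∈ q∉
  ... | tri> _ _ q<p  = contradiction (downward x q<p p∈) q∉

  p-1<p : ∀ p → p ℚ.- 1ℚ ℚ.< p
  p-1<p p = subst (p ℚ.- 1ℚ ℚ.<_) (ℚₚ.+-identityʳ p)
    (ℚₚ.+-monoʳ-< p (ℚₚ.negative⁻¹ (ℚ.- 1ℚ)))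

  p<p+1 : ∀ p → p ℚ.< p ℚ.+ 1ℚ
  p<p+1 p = subst (ℚ._< p ℚ.+ 1ℚ) (ℚₚ.+-identityʳ p)
    (ℚₚ.+-monoʳ-< p (ℚₚ.positive⁻¹ 1ℚ))

  neg-involutive : ∀ p → ℚ.- (ℚ.- p) ≡ p
  neg-involutive = solve 1 (λ p → :- (:- p) := p) refl
    where open +-*-Solver

  [p-q]+q≡p : ∀ p q → (p ℚ.- q) ℚ.+ q ≡ p
  [p-q]+q≡p = solve 2 (λ p q → (p :- q) :+ q := p) refl
    where open +-*-Solver

  p+[q-p]≡q : ∀ p q → p ℚ.+ (q ℚ.- p) ≡ q
  p+[q-p]≡q = solve 2 (λ p q → p :+ (q :- p) := q) refl
    where open +-*-Solver

fromℚ : ℚ → ℝ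
fromℚ q = record
  { lower     = ℚ._< q
  ; inhabited = q ℚ.- 1ℚ , p-1<p q
  ; bounded   = q , ℚₚ.<-irrefl refl
  ; downward  = ℚₚ.<-trans
  ; rounded   = λ p<q → let r , p<r , r<q = ℚₚ.<-dense p<q in r , p<r , r<q
  }

0ℝ 1ℝ : ℝ
0ℝ = fromℚ 0ℚ
1ℝ = fromℚ 1ℚ

infixl 6 _+_ _-_
infix  8 -_

_+_ : ℝ → ℝ → ℝ
x + y = record
  { lower     = λ p → ∃[ r ] ∃[ s ] r ∈ lower x × s ∈ lower y × p ℚ.< r ℚ.+ s
  ; inhabited = let r , r∈ = inhabited x ; s , s∈ = inhabited y in
                (r ℚ.+ s) ℚ.- 1ℚ , r , s , r∈ , s∈ , p-1<p (r ℚ.+ s)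
  ; bounded   = let q , q∉ = bounded x ; q′ , q′∉ = bounded y in
                q ℚ.+ q′ , λ (r , s , r∈ , s∈ , q+q′<r+s) →
                  ℚₚ.<-asym q+q′<r+s
                    (ℚₚ.+-mono-< (<-of-∉ x r∈ q∉) (<-of-∉ y s∈ q′∉))
  ; downward  = λ p<q (r , s , r∈ , s∈ , q<) →
                r , s , r∈ , s∈ , ℚₚ.<-trans p<q q<
  ; rounded   = λ (r , s , r∈ , s∈ , p<) →
                let q , p<q , q< = ℚₚ.<-dense p< in
                q , p<q , r , s , r∈ , s∈ , q<
  }

-_ : ℝ → ℝ
- x = record
  { lower     = λ p → ∃[ r ] p ℚ.< r × ℚ.- r ∉ lower x
  ; inhabited = let q , q∉ = bounded x in
                ℚ.- q ℚ.- 1ℚ , ℚ.- q , p-1<p (ℚ.- q) ,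
                subst (_∉ lower x) (sym (neg-involutive q)) q∉
  ; bounded   = let q , q∈ = inhabited x in
                ℚ.- q , λ (r , -q<r , -r∉) →
                  -r∉ (downward x
                    (subst (ℚ.- r ℚ.<_) (neg-involutive q) (ℚₚ.neg-antimono-< -q<r)) q∈)
  ; downward  = λ p<q (r , q<r , -r∉) → r , ℚₚ.<-trans p<q q<r , -r∉
  ; rounded   = λ (r , p<r , -r∉) →
                let q , p<q , q<r = ℚₚ.<-dense p<r in q , p<q , r , q<r , -r∉
  }

_-_ : ℝ → ℝ → ℝ
x - y = x + (- y)

min : ℝ → ℝ → ℝ
min x y = record
  { lower     = λ p → p ∈ lower x × p ∈ lower y
  ; inhabited = inh
  ; bounded   = let q , q∉ = bounded x in q , λ (q∈ , _) → q∉ q∈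
  ; downward  = λ p<q (q∈x , q∈y) → downward x p<q q∈x , downward y p<q q∈y
  ; rounded   = rnd
  }
  where
  inh : ∃[ p ] p ∈ lower x × p ∈ lower y
  inh with inhabited x | inhabited y
  ... | r , r∈ | s , s∈ with ℚₚ.<-cmp r s
  ... | tri< r<s _ _  = r , r∈ , downward y r<s s∈
  ... | tri≈ _ refl _ = r , r∈ , s∈
  ... | tri> _ _ s<r  = s , downward x s<r r∈ , s∈
  rnd : ∀ {p} → p ∈ lower x × p ∈ lower y →
        ∃[ q ] p ℚ.< q × (q ∈ lower x × q ∈ lower y)
  rnd (p∈x , p∈y) with rounded x p∈x | rounded y p∈y
  ... | r , p<r , r∈ | s , p<s , s∈ with ℚₚ.<-cmp r s
  ... | tri< r<s _ _  = r , p<r , r∈ , downward y r<s s∈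
  ... | tri≈ _ refl _ = r , p<r , r∈ , s∈
  ... | tri> _ _ s<r  = s , p<s , downward x s<r r∈ , s∈

max : ℝ → ℝ → ℝ
max x y = record
  { lower     = λ p → p ∈ lower x ⊎ p ∈ lower y
  ; inhabited = let q , q∈ = inhabited x in q , inj₁ q∈
  ; bounded   = bnd
  ; downward  = λ { p<q (inj₁ q∈) → inj₁ (downward x p<q q∈)
                  ; p<q (inj₂ q∈) → inj₂ (downward y p<q q∈) }
  ; rounded   = λ { (inj₁ p∈) → let q , p<q , q∈ = rounded x p∈ in q , p<q , inj₁ q∈
                  ; (inj₂ p∈) → let q , p<q , q∈ = rounded y p∈ in q , p<q , inj₂ q∈ }
  }
  where
  bnd : ∃[ q ] ¬ (q ∈ lower x ⊎ q ∈ lower y)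
  bnd with bounded x | bounded y
  ... | r , r∉ | s , s∉ with ℚₚ.<-cmp r s
  ... | tri< r<s _ _  = s , λ { (inj₁ s∈) → r∉ (downward x r<s s∈) ; (inj₂ s∈) → s∉ s∈ }
  ... | tri≈ _ refl _ = r , λ { (inj₁ r∈) → r∉ r∈ ; (inj₂ r∈) → s∉ r∈ }
  ... | tri> _ _ s<r  = r , λ { (inj₁ r∈) → r∉ r∈ ; (inj₂ r∈) → s∉ (downward y s<r r∈) }

∣_∣ : ℝ → ℝ
∣ x ∣ = max x (- x)

------------------------------------------------------------------------
-- The interval [0,1] and its operations

record 𝕀 : Set₁ where
  field
    real : ℝ
    0≤   : 0ℝ ≤ real
    ≤1   : real ≤ 1ℝ

open 𝕀 public using (real)

record ℚ[0,1] : Set where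
  constructor ⟨_,_,_⟩
  field
    value : ℚ
    0≤    : 0ℚ ℚ.≤ value
    ≤1    : value ℚ.≤ 1ℚ

record ℚ⟨0,1⟩ : Set where
  constructor ⟨_,_,_⟩
  field
    value : ℚ
    0<    : 0ℚ ℚ.< value
    <1    : value ℚ.< 1ℚ

fromℚ[0,1] : ℚ[0,1] → 𝕀
fromℚ[0,1] q = record
  { real = fromℚ (ℚ[0,1].value q)
  ; 0≤   = λ p<0 → ℚₚ.<-≤-trans p<0 (ℚ[0,1].0≤ q)
  ; ≤1   = λ p<q → ℚₚ.<-≤-trans p<q (ℚ[0,1].≤1 q)
  }

closed : ℚ⟨0,1⟩ → ℚ[0,1]
closed q = ⟨ ℚ⟨0,1⟩.value q , ℚₚ.<⇒≤ (ℚ⟨0,1⟩.0< q) , ℚₚ.<⇒≤ (ℚ⟨0,1⟩.<1 q) ⟩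

fromℚ⟨0,1⟩ : ℚ⟨0,1⟩ → ℝ
fromℚ⟨0,1⟩ q = fromℚ (ℚ⟨0,1⟩.value q)

private
  0+0≤ : ∀ {x y} → 0ℝ ≤ x → 0ℝ ≤ y → 0ℝ ≤ x + y
  0+0≤ {x} {y} 0≤x 0≤y {p} p<0 =
    let s , p<s , s<0 = ℚₚ.<-dense p<0
        r , p-s<r , r<0 = ℚₚ.<-dense
          (subst (p ℚ.- s ℚ.<_) (ℚₚ.+-inverseʳ s) (ℚₚ.+-monoˡ-< (ℚ.- s) p<s))
    in r , s , 0≤x r<0 , 0≤y s<0 ,
       subst (ℚ._< r ℚ.+ s) ([p-q]+q≡p p s) (ℚₚ.+-monoˡ-< s p-s<r)

  0≤1- : ∀ {x} → x ≤ 1ℝ → 0ℝ ≤ 1ℝ - x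
  0≤1- {x} x≤1 {p} p<0 =
    let p+1<1 = subst (p ℚ.+ 1ℚ ℚ.<_) (ℚₚ.+-identityˡ 1ℚ) (ℚₚ.+-monoˡ-< 1ℚ p<0)
        r , p+1<r , r<1 = ℚₚ.<-dense p+1<1
        p-r<-1 = subst₂ ℚ._<_ (solve 2 (λ p r → (p :+ con 1ℚ) :+ (:- con 1ℚ :+ :- r) := p :- r) refl p r)
                              (solve 1 (λ r → r :+ (:- con 1ℚ :+ :- r) := :- con 1ℚ) refl r)
                              (ℚₚ.+-monoˡ-< (ℚ.- 1ℚ ℚ.+ ℚ.- r) p+1<r)
        s , p-r<s , s<-1 = ℚₚ.<-dense p-r<-1
    in r , s , r<1 , (ℚ.- 1ℚ , s<-1 , λ 1∈x → ℚₚ.<-irrefl refl (x≤1 1∈x)) ,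
       subst (ℚ._< r ℚ.+ s) (p+[q-p]≡q r p) (ℚₚ.+-monoʳ-< r p-r<s)
    where open +-*-Solver

_⇒ᵢ_ : 𝕀 → 𝕀 → 𝕀
x ⇒ᵢ y = record
  { real = min ((1ℝ - real x) + real y) 1ℝ
  ; 0≤   = λ p<0 →
      0+0≤ {1ℝ - real x} {real y} (0≤1- {real x} (𝕀.≤1 x)) (𝕀.0≤ y) p<0 ,
      ℚₚ.<-trans p<0 (ℚₚ.positive⁻¹ 1ℚ)
  ; ≤1   = proj₂
  }

-- The argument of type I serves to make the supremum nonempty.
supᵢ : {I : Set} → I → (I → 𝕀) → 𝕀
supᵢ {I} i₀ x = record
  { real = record
    { lower     = λ p → ∃[ i ] p ∈ lower (real (x i))
    ; inhabited = let q , q∈ = inhabited (real (x i₀)) in q , i₀ , q∈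
    ; bounded   = 1ℚ , λ (i , 1∈) → ℚₚ.<-irrefl refl (𝕀.≤1 (x i) 1∈)
    ; downward  = λ p<q (i , q∈) → i , downward (real (x i)) p<q q∈
    ; rounded   = λ (i , p∈) →
        let q , p<q , q∈ = rounded (real (x i)) p∈ in q , p<q , i , q∈
    }
  ; 0≤   = λ p<0 → i₀ , 𝕀.0≤ (x i₀) p<0
  ; ≤1   = λ (i , p∈) → 𝕀.≤1 (x i) p∈
  }

------------------------------------------------------------------------
-- Metric spaces of diameter at most 1

record MetricSpace : Set₁ where
  infix 4 _≈_
  field
    Carrier         : Set
    _≈_             : Carrier → Carrier → Set
    d               : Carrier → Carrier → ℝ
    isGeneralMetric : IsGeneralMetric _≈_ _≃_ _≤_ 0ℝ _+_ d
    d≤1             : ∀ x y → d x y ≤ 1ℝ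

  open IsGeneralMetric isGeneralMetric public using (nonNegative)

  dᵢ : Carrier → Carrier → 𝕀
  dᵢ x y = record { real = d x y ; 0≤ = nonNegative ; ≤1 = d≤1 x y }

  dⁿ : ∀ {n} → Vec Carrier n → Vec Carrier n → ℝ
  dⁿ []       []       = 0ℝ
  dⁿ (x ∷ xs) (y ∷ ys) = max (d x y) (dⁿ xs ys)

  Continuous : ∀ {n} → (Vec Carrier n → 𝕀) → Set₁
  Continuous f = ∀ a (ε : ℝ) → 0ℝ < ε →
    Σ[ δ ∈ ℝ ] 0ℝ < δ ×
      (∀ b → dⁿ a b < δ → ∣ real (f a) - real (f b) ∣ < ε)

  Cauchy : (ℕ → Carrier) → Set₁
  Cauchy x = ∀ (ε : ℝ) → 0ℝ < ε →
    ∃[ N ] ∀ m n → N ℕ.≤ m → N ℕ.≤ n → d (x m) (x n) < ε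

  _ConvergesTo_ : (ℕ → Carrier) → Carrier → Set₁
  x ConvergesTo l = ∀ (ε : ℝ) → 0ℝ < ε →
    ∃[ N ] ∀ n → N ℕ.≤ n → d (x n) l < ε

  Complete : Set₁
  Complete = ∀ x → Cauchy x → ∃[ l ] x ConvergesTo l

------------------------------------------------------------------------
-- Metric signatures and structures

record Signature : Set₁ where
  field
    Fun Rel Con : Set
    arityF   : Fun → ℕ
    arityR   : Rel → ℕ
    modulusF : Fun → ℚ⟨0,1⟩ → ℚ⟨0,1⟩
    modulusR : Rel → ℚ⟨0,1⟩ → ℚ⟨0,1⟩

-- Structures are nonempty, as usual in model theory.  Interpretations
-- respect _≈_ because they respect a modulus of continuity.

record Structure (S : Signature) : Set₁ where
  open Signature S
  field
    metricSpace : MetricSpace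

  open MetricSpace metricSpace public

  field
    point : Carrier
    fun   : (f : Fun) → Vec Carrier (arityF f) → Carrier
    rel   : (P : Rel) → Vec Carrier (arityR P) → 𝕀
    con   : Con → Carrier
    fun-modulus : ∀ f ε a b → dⁿ a b < fromℚ⟨0,1⟩ (modulusF f ε) →
                  d (fun f a) (fun f b) ≤ fromℚ⟨0,1⟩ ε
    rel-modulus : ∀ P ε a b → dⁿ a b < fromℚ⟨0,1⟩ (modulusR P ε) →
                  ∣ real (rel P a) - real (rel P b) ∣ ≤ fromℚ⟨0,1⟩ ε

module _ (S : Signature) where
  open Signature S

  ----------------------------------------------------------------------
  -- Terms and formulas with free variables among the n variables of Fin n

  data Term (n : ℕ) : Set where
    var : Fin n → Term n
    con : Con → Term n
    fun : (f : Fun) → Vec (Term n) (arityF f) → Term n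

  -- sup binds variable zero.  Finiteness of the total number of free
  -- variables of a countable supremum is enforced by the index.

  infixr 5 _⇒_

  data Formula : ℕ → Set where
    dist  : ∀ {n} → Term n → Term n → Formula n
    rel   : ∀ {n} (P : Rel) → Vec (Term n) (arityR P) → Formula n
    const : ∀ {n} → ℚ[0,1] → Formula n
    _⇒_   : ∀ {n} → Formula n → Formula n → Formula n
    sup   : ∀ {n} → Formula (suc n) → Formula n
    supω  : ∀ {n} → (ℕ → Formula n) → Formula n

module _ {S : Signature} where
  open Signature S

  infixr 6 _∨_
  infixr 7 _∧_
  infix  8 ~_

  ~_ : ∀ {n} → Formula S n → Formula S n
  ~ φ = φ ⇒ const ⟨ 0ℚ , ℚₚ.≤-refl , ℚₚ.<⇒≤ (ℚₚ.positive⁻¹ 1ℚ) ⟩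

  _∨_ _∧_ : ∀ {n} → Formula S n → Formula S n → Formula S n
  φ ∨ ψ = (φ ⇒ ψ) ⇒ ψ
  φ ∧ ψ = ~ (~ φ ∨ ~ ψ)

  ----------------------------------------------------------------------
  -- Simultaneous substitution

  mutual
    _[_]ₜ : ∀ {m n} → Term S m → Vec (Term S n) m → Term S n
    var x    [ σ ]ₜ = lookup σ x
    con c    [ σ ]ₜ = con c
    fun f ts [ σ ]ₜ = fun f (ts [ σ ]ₜₛ)

    _[_]ₜₛ : ∀ {m n k} → Vec (Term S m) k → Vec (Term S n) m → Vec (Term S n) k
    []       [ σ ]ₜₛ = []
    (t ∷ ts) [ σ ]ₜₛ = (t [ σ ]ₜ) ∷ (ts [ σ ]ₜₛ)

  vars : ∀ {m n} → (Fin m → Fin n) → Vec (Term S n) m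
  vars ρ = tabulate (λ i → var (ρ i))

  lift : ∀ {m n} → Vec (Term S n) m → Vec (Term S (suc n)) (suc m)
  lift σ = var zero ∷ (σ [ vars suc ]ₜₛ)

  _[_] : ∀ {m n} → Formula S m → Vec (Term S n) m → Formula S n
  dist s t [ σ ] = dist (s [ σ ]ₜ) (t [ σ ]ₜ)
  rel P ts [ σ ] = rel P (ts [ σ ]ₜₛ)
  const q  [ σ ] = const q
  (φ ⇒ ψ)  [ σ ] = (φ [ σ ]) ⇒ (ψ [ σ ])
  sup φ    [ σ ] = sup (φ [ lift σ ])
  supω φ   [ σ ] = supω (λ i → φ i [ σ ])

  ----------------------------------------------------------------------
  -- Semantics

  module _ (M : Structure S) where
    private module M = Structure M

    mutual
      evalₜ : ∀ {n} → Term S n → Vec M.Carrier n → M.Carrier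
      evalₜ (var x)    a = lookup a x
      evalₜ (con c)    a = M.con c
      evalₜ (fun f ts) a = M.fun f (evalₜₛ ts a)

      evalₜₛ : ∀ {n k} → Vec (Term S n) k → Vec M.Carrier n → Vec M.Carrier k
      evalₜₛ []       a = []
      evalₜₛ (t ∷ ts) a = evalₜ t a ∷ evalₜₛ ts a

    eval : ∀ {n} → Formula S n → Vec M.Carrier n → 𝕀
    eval (dist s t) a = M.dᵢ (evalₜ s a) (evalₜ t a)
    eval (rel P ts) a = M.rel P (evalₜₛ ts a)
    eval (const q)  a = fromℚ[0,1] q
    eval (φ ⇒ ψ)    a = eval φ a ⇒ᵢ eval ψ a
    eval (sup φ)    a = supᵢ M.point (λ x → eval φ (x ∷ a))
    eval (supω φ)   a = supᵢ 0 (λ i → eval (φ i) a)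

  infix 4 _⊨_at_ _⊨*_

  _⊨_at_ : (M : Structure S) → ∀ {n} → Formula S n →
           Vec (Structure.Carrier M) n → Set
  M ⊨ φ at a = real (eval M φ a) ≃ 1ℝ

  Realizes : (M : Structure S) → ∀ {n} → Pred (Formula S n) 0ℓ →
             Vec (Structure.Carrier M) n → Set
  Realizes M Φ a = ∀ {φ} → φ ∈ Φ → M ⊨ φ at a

  _⊨*_ : Structure S → Pred (Formula S 0) 0ℓ → Set
  M ⊨* T = Realizes M T []

  Satisfiable : Pred (Formula S 0) 0ℓ → Set₁
  Satisfiable T = Σ[ M ∈ Structure S ] M ⊨* T

  Omits : (M : Structure S) → ∀ {n} → Pred (Formula S n) 0ℓ → Set
  Omits M Φ = ∀ a → ¬ Realizes M Φ a

  ----------------------------------------------------------------------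
  -- Fragments

  -- Closure under subformulas is part of the usual meaning of "fragment",
  -- and type omission fails without it: take the closure, under the other
  -- rules, of the atomic formulas, the constants and the sentence
  -- χ = sup_n inf_{m ≥ n} P_m(c), and let T consist of χ and all
  -- P_m(c) ∨ ~ P_m(c).  Then Φ_n = {P_m(c) : m ≥ n} is not metrically
  -- principal, as only finitely many P_m occur in a formula outside copies
  -- of χ, yet every model of T realizes some Φ_n.

  record IsFragment (L : (n : ℕ) → Pred (Formula S n) 0ℓ) : Set where
    field
      dist-∈  : ∀ {n} s t → dist s t ∈ L n
      rel-∈   : ∀ {n} P ts → rel P ts ∈ L n
      const-∈ : ∀ {n} q → const q ∈ L n
      sup-∈   : ∀ {n} {φ : Formula S (suc n)} → φ ∈ L (suc n) → sup φ ∈ L n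
      ⇒-∈     : ∀ {n} {φ ψ : Formula S n} → φ ∈ L n → ψ ∈ L n → (φ ⇒ ψ) ∈ L n
      ~-∈     : ∀ {n} {φ : Formula S n} → φ ∈ L n → ~ φ ∈ L n
      []-∈    : ∀ {m n} {φ : Formula S m} (σ : Vec (Term S n) m) →
                φ ∈ L m → φ [ σ ] ∈ L n
      sup-sub  : ∀ {n} {φ : Formula S (suc n)} → sup φ ∈ L n → φ ∈ L (suc n)
      ⇒-subˡ   : ∀ {n} {φ ψ : Formula S n} → (φ ⇒ ψ) ∈ L n → φ ∈ L n
      ⇒-subʳ   : ∀ {n} {φ ψ : Formula S n} → (φ ⇒ ψ) ∈ L n → ψ ∈ L n
      supω-sub : ∀ {n} {φ : ℕ → Formula S n} → supω φ ∈ L n → ∀ i → φ i ∈ L n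

  IsContinuous : (L : (n : ℕ) → Pred (Formula S n) 0ℓ) → Set₁
  IsContinuous L = ∀ {n} {φ : Formula S n} → φ ∈ L n →
    (M : Structure S) → Structure.Continuous M (eval M φ)

  IsCountable : (L : (n : ℕ) → Pred (Formula S n) 0ℓ) → Set
  IsCountable L = Σ[ e ∈ (ℕ → ∃ (Formula S)) ]
    (∀ {n} {φ : Formula S n} → φ ∈ L n → ∃[ k ] e k ≡ (n , φ))

  ----------------------------------------------------------------------
  -- Theories and types

  module _ (L : (n : ℕ) → Pred (Formula S n) 0ℓ) where

    IsTheory : Pred (Formula S 0) 0ℓ → Set
    IsTheory T = T ⊆ L 0

    module _ (T : Pred (Formula S 0) 0ℓ) where

      IsType : ∀ {n} → Pred (Formula S n) 0ℓ → Set₁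
      IsType {n} Φ = Φ ⊆ L n ×
        (Σ[ M ∈ Structure S ] M ⊨* T × ∃[ a ] Realizes M Φ a)

      Principal : ∀ {n} → Pred (Formula S n) 0ℓ → Set₁
      Principal {n} Φ =
        Σ[ m ∈ ℕ ] Σ[ φ ∈ Formula S m ] Σ[ t ∈ Vec (Term S m) n ] Σ[ r ∈ ℚ⟨0,1⟩ ]
          φ ∈ L m ×
          (Σ[ M ∈ Structure S ] M ⊨* T × ∃[ b ] M ⊨ φ at b) ×
          ((M : Structure S) → M ⊨* T → ∀ b →
             fromℚ⟨0,1⟩ r ≤ real (eval M φ b) →
             Realizes M Φ (evalₜₛ M t b))

  sups : ∀ m {n} → Formula S (m ℕ.+ n) → Formula S n
  sups zero    φ = φ
  sups (suc m) φ = sups m (sup φ)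

  -- In the scope of the n suprema, i ↑ˡ n is the i-th bound variable y
  -- and n ↑ʳ i the i-th free variable x (so y₀ is bound innermost).
  near : ℚ⟨0,1⟩ → ∀ {n} → Formula S n → Formula S n
  near δ {n} σ = sups n
    (foldr _∧_ (σ [ vars (_↑ˡ n) ])
      (map (λ i → dist (var (n ↑ʳ i)) (var (i ↑ˡ n)) ⇒ const (closed δ)) (allFin n)))

  _^_ : ∀ {n} → Pred (Formula S n) 0ℓ → ℚ⟨0,1⟩ → Pred (Formula S n) 0ℓ
  (Φ ^ δ) φ = ∃[ σ ] σ ∈ Φ × φ ≡ near δ σ

  MetricallyPrincipal : (L : (n : ℕ) → Pred (Formula S n) 0ℓ) →
    Pred (Formula S 0) 0ℓ → ∀ {n} → Pred (Formula S n) 0ℓ → Set₁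
  MetricallyPrincipal L T Φ = ∀ δ → Principal L T (Φ ^ δ)

{-# OPTIONS --safe #-}

-- A non-principal type can be omitted by forcing with conditions "q < φ(c̄)",
-- φ ∈ L, on a model of T with countably many named elements.  Each condition is,
-- up to merging, a single formula of L, so that a condition forcing a tuple of
-- terms to realize the type would witness principality.  A sufficiently generic
-- chain of conditions therefore yields a model on the terms in the names, where
-- the value of φ is the supremum of the q for which q < φ is forced, satisfying
-- T and omitting the types (Φ n)^δₙ, for δₙ such that these are not principal.
-- In its completion all L-formulas keep their values, by continuity.  If a tuple
-- of the completion realized Φ n, any tuple of terms within δₙ would realize
-- (Φ n)^δₙ.

module Submission where

open import Data.Nat.Base using (ℕ; zero; suc)
open import Data.Product.Base using (Σ-syntax; _×_)
open import Level using (0ℓ)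
open import Axiom.ExcludedMiddle using (ExcludedMiddle)
open import Relation.Nullary using (¬_)
open import Relation.Unary using (Pred)
open import Defs

import Data.Nat.Base as ℕ
import Data.Nat.Properties as ℕₚ
import Data.Integer.Base as ℤ
import Data.Integer.Properties as ℤₚ
import Data.Nat.Coprimality as Coprime
open import Data.Product.Base using (∃; ∃-syntax; _,_; proj₁; proj₂)
open import Data.Empty using (⊥)
open import Data.Unit.Base using (⊤; tt)
open import Data.Bool.Base using (Bool; true; false)
open import Data.Fin.Base using (Fin; zero; suc; toℕ; _↑ˡ_; _↑ʳ_)
open import Data.List.Base as List using (List; []; _∷_; _++_)
open import Data.List.Relation.Unary.All as All using (All; []; _∷_)
import Data.List.Relation.Unary.All.Properties as Allₚ
open import Data.Maybe.Base using (Maybe; just; nothing)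
open import Data.Vec.Base as Vec using (Vec; []; _∷_; lookup; tabulate)
import Data.Vec.Properties as Vecₚ
open import Data.Sum.Base using (_⊎_; inj₁; inj₂; [_,_]′)
open import Data.Rational.Base as ℚ using (ℚ; 0ℚ; 1ℚ; ½)
import Data.Rational.Properties as ℚₚ
open import Data.Rational.Solver using (module +-*-Solver)
open import Relation.Binary.PropositionalEquality
  using (_≡_; refl; sym; trans; cong; cong₂; subst; subst₂)
open import Function.Metric.Structures using (IsGeneralMetric)
open import Relation.Binary.Structures using (IsPartialOrder)
open import Relation.Binary.Definitions using (tri<; tri≈; tri>)
open import Relation.Nullary using (yes; no; contradiction)
open import Relation.Nullary.Decidable
  using (decidable-stable; recompute; from-yes; True; toWitness; fromWitness)
open import Relation.Unary using (_∈_; _∉_; _⊆_)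
open +-*-Solver using (solve; _:=_; _:+_; _:-_; :-_; _:*_) renaming (con to :con)

-- Forcing is semantic: a condition is kept satisfiable by a world, that is, a model of `T` with an
-- assignment of the names, and it forces what holds in all its worlds. So neither a proof calculus
-- nor compactness enters. The obstacle is that truth values are reals while conditions are strict
-- lower bounds. An upper bound `φ < q` becomes a lower bound on `~ φ`, and `φ ≤ q` is not a
-- condition at all. A value is therefore decided only up to a gap, and each passage between values
-- and forced bounds gives away a little room, which the strictness of the bounds supplies. The same
-- room yields the threshold below 1 that principality asks for. Decisions alone do not make the
-- forced values compositional: the rationals behind an implication and the name or index behind a
-- supremum must be met along the chain as well. The chain treats only countably many tuples of
-- terms, too few for the points of a complete space. This is why the enlarged types are omitted:
-- they turn omission by a dense set of tuples into omission by all.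

open ℚ⟨0,1⟩ using () renaming (value to val)

-- Rational arithmetic

-- Linear inequalities are reduced to a ring identity: c < d follows from a < b
-- if d - c = b - a, which is stated without subtraction.
<-by : ∀ {a b c d} → a ℚ.< b → c ℚ.+ b ≡ d ℚ.+ a → c ℚ.< d
<-by {a} {b} {c} {d} a<b c+b≡d+a = subst₂ ℚ._<_ (cancel c) (cancel d)
  (ℚₚ.+-monoˡ-< (ℚ.- a) (subst (c ℚ.+ a ℚ.<_) c+b≡d+a (ℚₚ.+-monoʳ-< c a<b)))
  where
  cancel : ∀ e → e ℚ.+ a ℚ.+ ℚ.- a ≡ e
  cancel e = solve 2 (λ e a → e :+ a :+ :- a := e) refl e a

≤-by : ∀ {a b c d} → a ℚ.≤ b → c ℚ.+ b ≡ d ℚ.+ a → c ℚ.≤ d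
≤-by {a} {b} {c} {d} a≤b c+b≡d+a = subst₂ ℚ._≤_ (cancel c) (cancel d)
  (ℚₚ.+-monoˡ-≤ (ℚ.- a) (subst (c ℚ.+ a ℚ.≤_) c+b≡d+a (ℚₚ.+-monoʳ-≤ c a≤b)))
  where
  cancel : ∀ e → e ℚ.+ a ℚ.+ ℚ.- a ≡ e
  cancel e = solve 2 (λ e a → e :+ a :+ :- a := e) refl e a

0<1 : 0ℚ ℚ.< 1ℚ
0<1 = ℚₚ.positive⁻¹ 1ℚ

q<q+ε : ∀ {q ε} → 0ℚ ℚ.< ε → q ℚ.< q ℚ.+ ε
q<q+ε {q} {ε} 0<ε = <-by 0<ε (solve 2 (λ q ε → q :+ ε := q :+ ε :+ :con 0ℚ) refl q ε)

0<q-p : ∀ {p q} → p ℚ.< q → 0ℚ ℚ.< q ℚ.- p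
0<q-p {p} {q} p<q = <-by p<q (solve 2 (λ p q → :con 0ℚ :+ q := q :- p :+ p) refl p q)

-- Opaque and with an irrelevant argument, since otherwise conversion checking
-- unfolds the witness and the proof and explodes.
opaque
  dense : ∀ {p q} → .(p ℚ.< q) → ∃[ r ] p ℚ.< r × r ℚ.< q
  dense {p} {q} p<q =
    let r , p<r , r<q = ℚₚ.<-dense (recompute (p ℚₚ.<? q) p<q) in r , p<r , r<q

<-+-split : ∀ {p a b} → p ℚ.< a ℚ.+ b →
            ∃[ r ] ∃[ s ] r ℚ.< a × s ℚ.< b × p ℚ.< r ℚ.+ s
<-+-split {p} {a} {b} p<a+b =
  let r , p-b<r , r<a = dense {p ℚ.- b} {a}
        (<-by p<a+b (solve 3 (λ p a b → p :- b :+ (a :+ b) := a :+ p) refl p a b))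
      s , p-r<s , s<b = dense {p ℚ.- r} {b}
        (<-by p-b<r (solve 3 (λ p b r → p :- r :+ r := b :+ (p :- b)) refl p b r))
  in r , s , r<a , s<b ,
     <-by p-r<s (solve 3 (λ p r s → p :+ s := r :+ s :+ (p :- r)) refl p r s)

lower-bound : ∀ {a b} → 0ℚ ℚ.< a → 0ℚ ℚ.< b →
              ∃[ c ] 0ℚ ℚ.< c × c ℚ.≤ a × c ℚ.≤ b
lower-bound {a} {b} 0<a 0<b with ℚₚ.≤-total a b
... | inj₁ a≤b = a , 0<a , ℚₚ.≤-refl , a≤b
... | inj₂ b≤a = b , 0<b , b≤a , ℚₚ.≤-refl


opaque
  halve : ∀ {κ} → .(0ℚ ℚ.< κ) → Σ[ ε ∈ ℚ⟨0,1⟩ ] val ε ℚ.+ val ε ℚ.< κ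
  halve {κ} 0<κ =
    let κ′ , 0<κ′ , κ′<κ = dense 0<κ
        a , 0<a , a<κ′ = dense 0<κ′
        b , 0<b , b≤a , b≤κ′-a = lower-bound 0<a (0<q-p a<κ′)
        -- The cap at ½ keeps the witness below 1 however large κ is; 2c ≤ a + (κ′ - a) = κ′ < κ.
        c , 0<c , c≤b , c≤½ = lower-bound {b} {½} 0<b (ℚₚ.positive⁻¹ ½)
    in ⟨ c , 0<c , ℚₚ.≤-<-trans c≤½ (from-yes (½ ℚₚ.<? 1ℚ)) ⟩ ,
       ℚₚ.≤-<-trans (ℚₚ.+-mono-≤ (ℚₚ.≤-trans c≤b b≤a) (ℚₚ.≤-trans c≤b b≤κ′-a))
         (subst (ℚ._< κ) (solve 2 (λ a k → k := a :+ (k :- a)) refl a κ′) κ′<κ)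

-- Built with `mkℚ` so that numerator and denominator reduce without a gcd.
fromℕ : ℕ → ℚ
fromℕ n = ℚ.mkℚ (ℤ.+ n) 0 (Coprime.sym (Coprime.1-coprimeTo n))

fromℕ-suc : ∀ n → fromℕ (suc n) ≡ 1ℚ ℚ.+ fromℕ n
fromℕ-suc n = trans (sym (ℚₚ.↥p/↧p≡p (fromℕ (suc n))))
  (cong (ℚ._/ 1) (cong (ℤ._+_ (ℤ.+ 1)) (sym (ℤₚ.*-identityʳ (ℤ.+ n)))))

∃-fromℕ-≥ : ∀ q → ∃[ n ] q ℚ.≤ fromℕ n
∃-fromℕ-≥ q@(ℚ.mkℚ i d-1 _) = ℤ.∣ i ∣ , ℚ.*≤* (begin
  i ℤ.* ℤ.+ 1                     ≡⟨ ℤₚ.*-identityʳ i ⟩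
  i                               ≤⟨ i≤∣i∣ i ⟩
  ℤ.+ ℤ.∣ i ∣                     ≤⟨ ℤ.+≤+ (ℕₚ.m≤m*n ℤ.∣ i ∣ (suc d-1)) ⟩
  ℤ.+ (ℤ.∣ i ∣ ℕ.* suc d-1)     ≡⟨ ℤₚ.pos-* ℤ.∣ i ∣ (suc d-1) ⟩
  ℤ.+ ℤ.∣ i ∣ ℤ.* ℤ.+ suc d-1   ∎)
  where
  open ℤₚ.≤-Reasoning
  i≤∣i∣ : ∀ i → i ℤ.≤ ℤ.+ ℤ.∣ i ∣
  i≤∣i∣ (ℤ.+ n)      = ℤₚ.≤-refl
  i≤∣i∣ (ℤ.-[1+ n ]) = ℤ.-≤+

archimedean : ∀ {ε} → 0ℚ ℚ.< ε → ∀ a → ∃[ n ] a ℚ.≤ fromℕ n ℚ.* ε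
archimedean {ε} 0<ε a = n , (begin
  a                         ≡⟨ sym (ℚₚ.*-identityʳ a) ⟩
  a ℚ.* 1ℚ                  ≡⟨ cong (a ℚ.*_) (sym (ℚₚ.*-inverseˡ ε)) ⟩
  a ℚ.* (ℚ.1/ ε ℚ.* ε)      ≡⟨ sym (ℚₚ.*-assoc a (ℚ.1/ ε) ε) ⟩
  a ℚ.* ℚ.1/ ε ℚ.* ε        ≤⟨ ℚₚ.*-monoʳ-≤-nonNeg ε a/ε≤n ⟩
  fromℕ n ℚ.* ε             ∎)
  where
  open ℚₚ.≤-Reasoning
  instance
    ε-pos : ℚ.Positive ε
    ε-pos = ℚ.positive 0<ε
    ε-nonNeg : ℚ.NonNegative ε
    ε-nonNeg = ℚₚ.pos⇒nonNeg ε
    ε-nonZero : ℚ.NonZero ε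
    ε-nonZero = ℚₚ.pos⇒nonZero ε
  n = proj₁ (∃-fromℕ-≥ (a ℚ.* ℚ.1/ ε))
  a/ε≤n = proj₂ (∃-fromℕ-≥ (a ℚ.* ℚ.1/ ε))

-- Cuts through rational bounds

∈-downward : ∀ x {p q} → p ℚ.≤ q → q ∈ lower x → p ∈ lower x
∈-downward x {p} {q} p≤q q∈x with ℚₚ.<-cmp p q
... | tri< p<q _ _  = downward x p<q q∈x
... | tri≈ _ refl _ = q∈x
... | tri> _ _ q<p  = contradiction (ℚₚ.<-≤-trans q<p p≤q) (ℚₚ.<-irrefl refl)

-- Throughout, `p ∈ lower x` is used as p < x and `q ∉ lower x` as x ≤ q, which avoids arithmetic on
-- cuts.
∈-∉⇒< : ∀ x {p q} → p ∈ lower x → q ∉ lower x → p ℚ.< q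
∈-∉⇒< x p∈x q∉x = ℚₚ.≰⇒> λ q≤p → q∉x (∈-downward x q≤p p∈x)

∉-upward : ∀ x {p q} → p ℚ.≤ q → p ∉ lower x → q ∉ lower x
∉-upward x p≤q p∉x q∈x = p∉x (∈-downward x p≤q q∈x)

∉⇒0≤ : ∀ x {q} → 0ℝ ≤ x → q ∉ lower x → 0ℚ ℚ.≤ q
∉⇒0≤ x 0≤x q∉x = ℚₚ.≮⇒≥ λ q<0 → q∉x (0≤x q<0)

≤-refl : ∀ {x} → x ≤ x
≤-refl p∈ = p∈

≤-isPartialOrder : IsPartialOrder _≃_ _≤_
≤-isPartialOrder = record
  { isPreorder = record
    { isEquivalence = record
      { refl  = λ {x} → ≤-refl {x} , ≤-refl {x}
      ; sym   = λ (x≤y , y≤x) → y≤x , x≤y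
      ; trans = λ (x≤y , y≤x) (y≤z , z≤y) →
                  (λ p∈ → y≤z (x≤y p∈)) , (λ p∈ → y≤x (z≤y p∈))
      }
    ; reflexive = proj₁
    ; trans     = λ x≤y y≤z p∈ → y≤z (x≤y p∈)
    }
  ; antisym = _,_
  }

-- Łukasiewicz connectives

≃1 : ∀ x → 1ℝ ≤ real x → real x ≃ 1ℝ
≃1 x 1≤x = 𝕀.≤1 x , 1≤x

-- Together with `⇒-elim` and `⇒-≤1` this describes the cut of an implication by rational bounds s <
-- y and x ≤ t, so that sums and negations of cuts need not be unfolded again.
⇒-intro : ∀ x y {p s t} → p ℚ.< 1ℚ → s ∈ lower (real y) → t ∉ lower (real x) →
          p ℚ.< 1ℚ ℚ.- t ℚ.+ s → p ∈ lower (real (x ⇒ᵢ y))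
⇒-intro x y {p} {s} {t} p<1 s∈y t∉x p<1-t+s =
  let r , p-s<r , r<1-t = dense {p ℚ.- s} {1ℚ ℚ.- t}
        (<-by p<1-t+s (solve 3 (λ p s t →
           p :- s :+ (:con 1ℚ :- t :+ s) := :con 1ℚ :- t :+ p) refl p s t))
      a , b , a<1 , b<-t , r<a+b = <-+-split r<1-t
  in (r , s , (a , b , a<1 ,
        (ℚ.- t , b<-t , subst (_∉ lower (real x)) (sym (neg-involutive t)) t∉x) ,
        r<a+b) , s∈y ,
      <-by p-s<r (solve 3 (λ p r s → p :+ r := r :+ s :+ (p :- s)) refl p r s)) ,
     p<1
  where
  neg-involutive : ∀ p → ℚ.- (ℚ.- p) ≡ p
  neg-involutive = solve 1 (λ p → :- (:- p) := p) refl

⇒-elim : ∀ x y {p} → p ∈ lower (real (x ⇒ᵢ y)) →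
         ∃[ s ] ∃[ t ] s ∈ lower (real y) × t ∉ lower (real x) ×
                       p ℚ.< 1ℚ ℚ.- t ℚ.+ s
⇒-elim x y {p} ((r , s , (a , b , a<1 , (u , b<u , -u∉x) , r<a+b) , s∈y , p<r+s) , _) =
  s , ℚ.- u , s∈y , -u∉x , ℚₚ.<-trans p<r+s (<-by
    (ℚₚ.<-trans r<a+b (ℚₚ.+-mono-< a<1 b<u))
    (solve 3 (λ r s u → r :+ s :+ (:con 1ℚ :+ u) := :con 1ℚ :- :- u :+ s :+ r)
       refl r s u))

⇒-≤1 : ∀ x y {p} → p ∈ lower (real (x ⇒ᵢ y)) → p ℚ.< 1ℚ
⇒-≤1 x y = proj₂

⇒-top : ∀ x y {q} → q ∉ lower (real x) → fromℚ q ≤ real y → 1ℝ ≤ real (x ⇒ᵢ y)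
⇒-top x y {q} q∉x q≤y {p} p<1 =
  let s , q-[1-p]<s , s<q = dense {q ℚ.- (1ℚ ℚ.- p)} {q}
        (<-by p<1 (solve 2 (λ p q → q :- (:con 1ℚ :- p) :+ :con 1ℚ := q :+ p) refl p q))
  in ⇒-intro x y p<1 (q≤y s<q) q∉x
       (<-by q-[1-p]<s (solve 3 (λ p q s →
          p :+ s := :con 1ℚ :- q :+ s :+ (q :- (:con 1ℚ :- p))) refl p q s))

-- Quantitative modus ponens: the strong conjunction v + p - 1 of the bounds on premise and
-- implication bounds the conclusion.
const⇒-elim : ∀ v y {p q} → q ℚ.≤ ℚ[0,1].value v ℚ.+ p ℚ.- 1ℚ →
              p ∈ lower (real (fromℚ[0,1] v ⇒ᵢ y)) → q ∈ lower (real y)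
const⇒-elim v y {p} {q} q≤v+p-1 p∈ =
  let s , t , s∈y , t≮v , p<1-t+s = ⇒-elim (fromℚ[0,1] v) y p∈
      w = ℚ[0,1].value v
  in downward (real y) (<-by
       (ℚₚ.+-mono-<-≤ p<1-t+s (ℚₚ.+-mono-≤ (ℚₚ.≮⇒≥ t≮v) q≤v+p-1))
       (solve 5 (λ p q s t w →
          q :+ (:con 1ℚ :- t :+ s :+ (t :+ (w :+ p :- :con 1ℚ))) := s :+ (p :+ (w :+ q)))
          refl p q s t w))
       s∈y

infix 22 ¬ᵢ_
infix 21 _⊗ᵢ_

0ᵢ : 𝕀
0ᵢ = fromℚ[0,1] ⟨ 0ℚ , ℚₚ.≤-refl , ℚₚ.<⇒≤ (ℚₚ.positive⁻¹ 1ℚ) ⟩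

¬ᵢ_ : 𝕀 → 𝕀
¬ᵢ x = x ⇒ᵢ 0ᵢ

-- With `¬ᵢ-elim`, this translates x < q into a strict lower bound on the negation, the only form in
-- which a constraint can bound a formula from above.
¬ᵢ-intro : ∀ x {q t} → t ∉ lower (real x) → t ℚ.< q → 1ℚ ℚ.- q ∈ lower (real (¬ᵢ x))
¬ᵢ-intro x {q} {t} t∉x t<q =
  let s , t-q<s , s<0 = dense {t ℚ.- q} {0ℚ}
        (<-by t<q (solve 2 (λ t q → t :- q :+ q := :con 0ℚ :+ t) refl t q))
  in ⇒-intro x 0ᵢ
       (<-by (ℚₚ.≤-<-trans (∉⇒0≤ (real x) (𝕀.0≤ x) t∉x) t<q)
         (solve 1 (λ q → :con 1ℚ :- q :+ q := :con 1ℚ :+ :con 0ℚ) refl q))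
       s<0 t∉x
       (<-by t-q<s (solve 3 (λ s t q →
          :con 1ℚ :- q :+ s := :con 1ℚ :- t :+ s :+ (t :- q)) refl s t q))

¬ᵢ-elim : ∀ x {q} → 1ℚ ℚ.- q ∈ lower (real (¬ᵢ x)) → ∃[ t ] t ∉ lower (real x) × t ℚ.< q
¬ᵢ-elim x {q} p∈ =
  let s , t , s<0 , t∉x , 1-q<1-t+s = ⇒-elim x 0ᵢ p∈
  in t , t∉x , <-by (ℚₚ.+-mono-< 1-q<1-t+s s<0)
       (solve 3 (λ s t q →
          t :+ (:con 1ℚ :- t :+ s :+ :con 0ℚ) := q :+ (:con 1ℚ :- q :+ s)) refl s t q)

1-[1-p]≡p : ∀ p → 1ℚ ℚ.- (1ℚ ℚ.- p) ≡ p
1-[1-p]≡p = solve 1 (λ p → :con 1ℚ :- (:con 1ℚ :- p) := p) refl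

¬-top : ∀ v → 1ℝ ≤ real v → ∀ {s} → s ∈ lower (real (¬ᵢ v)) → s ℚ.< 0ℚ
¬-top v 1≤v {s} s∈ =
  let r , t , r<0 , t∉v , s<1-t+r = ⇒-elim v 0ᵢ s∈
  in <-by (ℚₚ.+-mono-<-≤ s<1-t+r
       (ℚₚ.+-mono-≤ (ℚₚ.≮⇒≥ (λ t<1 → t∉v (1≤v t<1))) (ℚₚ.<⇒≤ r<0)))
       (solve 3 (λ r s t →
          s :+ (:con 1ℚ :- t :+ r :+ (t :+ :con 0ℚ)) := :con 0ℚ :+ (s :+ (:con 1ℚ :+ r)))
          refl r s t)

-- The conclusion is the value of `φ ∧ ψ` with `_∧_` unfolded. As ¬x is 0, the inner implication is
-- 1, so z collapses to ¬y, which is 0.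
∧-top : ∀ x y → 1ℝ ≤ real x → 1ℝ ≤ real y →
        1ℝ ≤ real (¬ᵢ ((¬ᵢ x ⇒ᵢ ¬ᵢ y) ⇒ᵢ ¬ᵢ y))
∧-top x y 1≤x 1≤y {p} p<1 = subst (_∈ lower (real (¬ᵢ z))) (1-[1-p]≡p p)
  (¬ᵢ-intro z 0∉z (0<q-p p<1))
  where
  z = (¬ᵢ x ⇒ᵢ ¬ᵢ y) ⇒ᵢ ¬ᵢ y
  0∉z : 0ℚ ∉ lower (real z)
  0∉z 0∈z =
    let s , t , s∈¬y , t∉ , 0<1-t+s = ⇒-elim (¬ᵢ x ⇒ᵢ ¬ᵢ y) (¬ᵢ y) 0∈z
        1≤t = ℚₚ.≮⇒≥ λ t<1 → t∉ (⇒-top (¬ᵢ x) (¬ᵢ y)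
                (λ 0∈ → ℚₚ.<-irrefl refl (¬-top x 1≤x 0∈)) (𝕀.0≤ (¬ᵢ y)) t<1)
    in ℚₚ.<-irrefl refl (ℚₚ.<-trans (¬-top y 1≤y s∈¬y)
         (<-by (ℚₚ.+-mono-<-≤ 0<1-t+s 1≤t)
           (solve 2 (λ s t → :con 0ℚ :+ (:con 1ℚ :- t :+ s :+ t) := s :+ (:con 0ℚ :+ :con 1ℚ))
              refl s t)))

-- The strong conjunction of Łukasiewicz logic, max(0, x + y - 1).  Like the
-- minimum it is 1 only at (1, 1) and lies below both arguments.
_⊗ᵢ_ : 𝕀 → 𝕀 → 𝕀
x ⊗ᵢ y = ¬ᵢ (x ⇒ᵢ ¬ᵢ y)

⊗-top : ∀ x y → 1ℝ ≤ real x → 1ℝ ≤ real y → 1ℝ ≤ real (x ⊗ᵢ y)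
⊗-top x y 1≤x 1≤y {p} p<1 = subst (_∈ lower (real (x ⊗ᵢ y))) (1-[1-p]≡p p)
  (¬ᵢ-intro (x ⇒ᵢ ¬ᵢ y) 0∉ (0<q-p p<1))
  where
  0∉ : 0ℚ ∉ lower (real (x ⇒ᵢ ¬ᵢ y))
  0∉ 0∈ =
    let s , t , s∈¬y , t∉x , 0<1-t+s = ⇒-elim x (¬ᵢ y) 0∈
    in ℚₚ.<-irrefl refl (ℚₚ.<-trans (¬-top y 1≤y s∈¬y)
         (<-by (ℚₚ.+-mono-<-≤ 0<1-t+s (ℚₚ.≮⇒≥ (λ t<1 → t∉x (1≤x t<1))))
           (solve 2 (λ s t → :con 0ℚ :+ (:con 1ℚ :- t :+ s :+ t) := s :+ (:con 0ℚ :+ :con 1ℚ))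
              refl s t)))

-- Consequences of excluded middle

module Classical (em : ∀ ℓ → ExcludedMiddle ℓ) where

  dne : ∀ {ℓ} {P : Set ℓ} → ¬ ¬ P → P
  dne {ℓ} = decidable-stable (em ℓ)

  ⊗-elimˡ : ∀ x y {p} → p ∈ lower (real (x ⊗ᵢ y)) → p ∈ lower (real x)
  ⊗-elimˡ x y {p} p∈ = dne λ p∉x →
    let t , t∉ , t<1-p = ¬ᵢ-elim (x ⇒ᵢ ¬ᵢ y) {1ℚ ℚ.- p}
                           (subst (_∈ lower (real (x ⊗ᵢ y))) (sym (1-[1-p]≡p p)) p∈)
        s , t-[1-p]<s , s<0 = dense {t ℚ.- (1ℚ ℚ.- p)} {0ℚ}
          (<-by t<1-p (solve 2 (λ p t →
             t :- (:con 1ℚ :- p) :+ (:con 1ℚ :- p) := :con 0ℚ :+ t) refl p t))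
    in t∉ (⇒-intro x (¬ᵢ y)
         (<-by (ℚₚ.+-mono-<-≤ t<1-p (∉⇒0≤ (real x) (𝕀.0≤ x) p∉x))
           (solve 2 (λ p t → t :+ (:con 1ℚ :- p :+ p) := :con 1ℚ :+ (t :+ :con 0ℚ)) refl p t))
         (𝕀.0≤ (¬ᵢ y) s<0) p∉x
         (<-by t-[1-p]<s (solve 3 (λ p s t →
            t :+ s := :con 1ℚ :- p :+ s :+ (t :- (:con 1ℚ :- p))) refl p s t)))

  ⊗-elimʳ : ∀ x y {p} → p ∈ lower (real (x ⊗ᵢ y)) → p ∈ lower (real y)
  ⊗-elimʳ x y {p} p∈ = dne λ p∉y →
    let t , t∉ , t<1-p = ¬ᵢ-elim (x ⇒ᵢ ¬ᵢ y) {1ℚ ℚ.- p}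
                           (subst (_∈ lower (real (x ⊗ᵢ y))) (sym (1-[1-p]≡p p)) p∈)
        q , p<q , q<1-t = dense {p} {1ℚ ℚ.- t}
          (<-by t<1-p (solve 2 (λ p t → p :+ (:con 1ℚ :- p) := :con 1ℚ :- t :+ t) refl p t))
    in t∉ (⇒-intro x (¬ᵢ y)
         (<-by (ℚₚ.+-mono-<-≤ t<1-p (∉⇒0≤ (real y) (𝕀.0≤ y) p∉y))
           (solve 2 (λ p t → t :+ (:con 1ℚ :- p :+ p) := :con 1ℚ :+ (t :+ :con 0ℚ)) refl p t))
         (¬ᵢ-intro y p∉y p<q)
         (λ 1∈x → ℚₚ.<-irrefl refl (𝕀.≤1 x 1∈x))
         (<-by q<1-t (solve 2 (λ q t →
            t :+ (:con 1ℚ :- t) := :con 1ℚ :- :con 1ℚ :+ (:con 1ℚ :- q) :+ q) refl q t)))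

  -- Otherwise the cut would be closed under adding ε and, starting from its element r, would reach
  -- its upper bound u after finitely many steps.
  located : ∀ x {ε} → 0ℚ ℚ.< ε → ∃[ q ] q ∈ lower x × q ℚ.+ ε ∉ lower x
  located x {ε} 0<ε = dne λ ¬located →
    let n , u-r≤nε = archimedean 0<ε (u ℚ.- r)
    in ∉-upward x (≤-by u-r≤nε
         (solve 3 (λ u r e → u :+ e := r :+ e :+ (u :- r)) refl u r (fromℕ n ℚ.* ε)))
         (proj₂ (bounded x)) (step (λ q∈ → dne λ ∉x → ¬located (_ , q∈ , ∉x)) n)
    where
    r = proj₁ (inhabited x)
    u = proj₁ (bounded x)
    step : (∀ {q} → q ∈ lower x → q ℚ.+ ε ∈ lower x) →
           ∀ n → r ℚ.+ fromℕ n ℚ.* ε ∈ lower x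
    step +ε∈ zero    = subst (_∈ lower x)
      (solve 2 (λ r ε → r := r :+ :con 0ℚ :* ε) refl r ε) (proj₂ (inhabited x))
    step +ε∈ (suc n) = subst (_∈ lower x)
      (trans (solve 3 (λ r m ε → r :+ m :* ε :+ ε := r :+ (:con 1ℚ :+ m) :* ε)
                refl r (fromℕ n) ε)
             (cong (λ m → r ℚ.+ m ℚ.* ε) (sym (fromℕ-suc n))))
      (+ε∈ (step +ε∈ n))

  ∣-∣≤-intro : ∀ x y {ε} →
    (∀ {q} → q ∉ lower y → q ℚ.+ ε ∉ lower x) →
    (∀ {q} → q ∉ lower x → q ℚ.+ ε ∉ lower y) →
    ∣ x - y ∣ ≤ fromℚ ε
  ∣-∣≤-intro x y {ε} x≤y+ε y≤x+ε {p} (inj₁ (r , s , r∈x , (u , s<u , -u∉y) , p<r+s)) =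
    <-by (ℚₚ.+-mono-< p<r+s (ℚₚ.+-mono-< (∈-∉⇒< x r∈x (x≤y+ε -u∉y)) s<u))
      (solve 5 (λ p r s u ε →
         p :+ (r :+ s :+ (:- u :+ ε :+ u)) := ε :+ (p :+ (r :+ s))) refl p r s u ε)
  ∣-∣≤-intro x y {ε} x≤y+ε y≤x+ε {p} (inj₂ (r , p<r , -r∉x-y)) =
    ℚₚ.<-≤-trans p<r (ℚₚ.≮⇒≥ λ ε<r →
      -- Locating y between b and b + κ gives x - y > (b - ε) - (b + κ) = -ε - κ > -r, against
      -- `-r∉x-y`.
      let κ , 0<κ , κ<r-ε = dense (0<q-p ε<r)
          b , b∈y , b+κ∉y = located y 0<κ
          b-ε∈x : b ℚ.- ε ∈ lower x
          b-ε∈x = dne λ ∉x → y≤x+ε ∉x (subst (_∈ lower y)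
                    (solve 2 (λ b ε → b := b :- ε :+ ε) refl b ε) b∈y)
          c , -r-[b-ε]<c , c<-[b+κ] = dense {ℚ.- r ℚ.- (b ℚ.- ε)} {ℚ.- (b ℚ.+ κ)}
            (<-by κ<r-ε (solve 4 (λ b r κ ε →
               :- r :- (b :- ε) :+ (r :- ε) := :- (b :+ κ) :+ κ) refl b r κ ε))
      in -r∉x-y (b ℚ.- ε , c , b-ε∈x ,
           (ℚ.- (b ℚ.+ κ) , c<-[b+κ] ,
            subst (_∉ lower y) (solve 1 (λ q → q := :- :- q) refl (b ℚ.+ κ)) b+κ∉y) ,
           <-by -r-[b-ε]<c (solve 4 (λ b c r ε →
             :- r :+ c := b :- ε :+ c :+ (:- r :- (b :- ε))) refl b c r ε)))

  ∣-∣≤-elimˡ : ∀ x y {ε q} → ∣ x - y ∣ ≤ fromℚ ε → q ℚ.+ ε ∈ lower x → q ∈ lower y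
  ∣-∣≤-elimˡ x y {ε} {q} x-y≤ε q+ε∈x = dne λ q∉y →
    let w , q+ε<w , w∈x = rounded x q+ε∈x
        c , ε-w<c , c<-q = dense {ε ℚ.- w} {ℚ.- q}
          (<-by q+ε<w (solve 3 (λ q w ε → ε :- w :+ w := :- q :+ (q :+ ε)) refl q w ε))
    in ℚₚ.<-irrefl refl (x-y≤ε (inj₁ (w , c , w∈x ,
         (ℚ.- q , c<-q , subst (_∉ lower y) (solve 1 (λ q → q := :- :- q) refl q) q∉y) ,
         <-by ε-w<c (solve 3 (λ c w ε → ε :+ c := w :+ c :+ (ε :- w)) refl c w ε))))

  ∣-∣≤-elimʳ : ∀ x y {ε q} → ∣ x - y ∣ ≤ fromℚ ε → q ℚ.+ ε ∈ lower y → q ∈ lower x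
  ∣-∣≤-elimʳ x y {ε} {q} x-y≤ε q+ε∈y = dne λ q∉x →
    let w , q+ε<w , w∈y = rounded y q+ε∈y
    in ℚₚ.<-irrefl refl (x-y≤ε (inj₂ (w ℚ.- q ,
         <-by q+ε<w (solve 3 (λ q w ε → ε :+ w := w :- q :+ (q :+ ε)) refl q w ε) ,
         λ (a , b , a∈x , (u , b<u , -u∉y) , -[w-q]<a+b) →
           ℚₚ.<-irrefl refl (<-by {c = 0ℚ} {0ℚ}
             (ℚₚ.+-mono-< -[w-q]<a+b (ℚₚ.+-mono-< (∈-∉⇒< x a∈x q∉x)
               (ℚₚ.+-mono-< b<u (∈-∉⇒< y w∈y -u∉y))))
             (solve 5 (λ q w a b u →
                :con 0ℚ :+ (a :+ b :+ (q :+ (u :+ :- u)))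
                  := :con 0ℚ :+ (:- (w :- q) :+ (a :+ (b :+ w)))) refl q w a b u)))))

  -- Metric spaces from upper bounds on distances

  module _ {C : Set} (d : C → C → 𝕀)
    (d-refl : ∀ x → real (d x x) ≤ 0ℝ)
    (d-sym : ∀ x y → real (d x y) ≤ real (d y x))
    (d-triangle : ∀ x y z {q r} → q ∉ lower (real (d x y)) → r ∉ lower (real (d y z)) →
                  q ℚ.+ r ∉ lower (real (d x z)))
    where

    private
      _≈_ : C → C → Set
      x ≈ y = real (d x y) ≃ 0ℝ

      0∉ : ∀ {x y} → x ≈ y → 0ℚ ∉ lower (real (d x y))
      0∉ (d≤0 , _) 0∈ = ℚₚ.<-irrefl refl (d≤0 0∈)

      ≈-sym : ∀ {x y} → x ≈ y → y ≈ x
      ≈-sym {x} {y} (d≤0 , _) = (λ p∈ → d≤0 (d-sym y x p∈)) , 𝕀.0≤ (d y x)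

      ≈-trans : ∀ {x y z} → x ≈ y → y ≈ z → x ≈ z
      ≈-trans {x} {y} {z} x≈y y≈z =
        (λ p∈ → ∈-∉⇒< (real (d x z)) p∈ (d-triangle x y z (0∉ x≈y) (0∉ y≈z))) ,
        𝕀.0≤ (d x z)

      d-mono : ∀ {x y u v} → x ≈ y → u ≈ v → real (d x u) ≤ real (d y v)
      d-mono {x} {y} {u} {v} x≈y u≈v {p} p∈ = dne λ p∉ →
        d-triangle x y u (0∉ x≈y) (d-triangle y v u p∉ (0∉ (≈-sym u≈v)))
          (subst (_∈ lower (real (d x u)))
            (solve 1 (λ p → p := :con 0ℚ :+ (p :+ :con 0ℚ)) refl p) p∈)

      -- Both distances are located up to ε, and the total error 2ε fits into the room between p and
      -- p′.
      triangle : ∀ x y z → real (d x z) ≤ real (d x y) + real (d y z)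
      triangle x y z {p} p∈ =
        let p′ , p<p′ , p′∈ = rounded (real (d x z)) p∈
            ε , ε+ε<p′-p = halve (0<q-p p<p′)
            r , r∈ , r+ε∉ = located (real (d x y)) (ℚ⟨0,1⟩.0< ε)
            s , s∈ , s+ε∉ = located (real (d y z)) (ℚ⟨0,1⟩.0< ε)
            p′<r+s+2ε = ∈-∉⇒< (real (d x z)) p′∈ (d-triangle x y z r+ε∉ s+ε∉)
        in r , s , r∈ , s∈ , <-by (ℚₚ.+-mono-< p′<r+s+2ε ε+ε<p′-p)
             (solve 5 (λ p p′ r s ε →
                p :+ ((r :+ ε :+ (s :+ ε)) :+ (p′ :- p)) := r :+ s :+ (p′ :+ (ε :+ ε)))
                refl p p′ r s (val ε))

    -- Serves both the term space and the completion. Equality is distance 0 by definition, so a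
    -- pseudometric needs no quotient.
    mkMetricSpace : MetricSpace
    mkMetricSpace = record
      { Carrier = C
      ; _≈_ = _≈_
      ; d = λ x y → real (d x y)
      ; isGeneralMetric = record
        { isSemiMetric = record
          { isQuasiSemiMetric = record
            { isPreMetric = record
              { isProtoMetric = record
                { isPartialOrder = ≤-isPartialOrder
                ; ≈-isEquivalence = record
                  { refl = λ {x} → d-refl x , 𝕀.0≤ (d x x)
                  ; sym = ≈-sym
                  ; trans = ≈-trans
                  }
                ; cong = λ x≈y u≈v → d-mono x≈y u≈v , d-mono (≈-sym x≈y) (≈-sym u≈v)
                ; nonNegative = λ {x} {y} → 𝕀.0≤ (d x y)
                }
              ; ≈⇒0 = λ x≈y → x≈y
              }
            ; 0⇒≈ = λ x≈y → x≈y
            }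
          ; sym = λ x y → d-sym x y , d-sym y x
          }
        ; triangle = triangle
        }
      ; d≤1 = λ x y → 𝕀.≤1 (d x y)
      }

≃-refl : ∀ x → x ≃ x
≃-refl x = ≤-refl {x} , ≤-refl {x}

⇒-mono : ∀ x x′ y y′ → real x′ ≤ real x → real y ≤ real y′ →
         real (x ⇒ᵢ y) ≤ real (x′ ⇒ᵢ y′)
⇒-mono x x′ y y′ x′≤x y≤y′ p∈ =
  let s , t , s∈y , t∉x , p<1-t+s = ⇒-elim x y p∈
  in ⇒-intro x′ y′ (⇒-≤1 x y p∈) (y≤y′ s∈y) (λ t∈x′ → t∉x (x′≤x t∈x′)) p<1-t+s

-- Substitution and enlarged types

module Substitution {S : Signature} (M : Structure S) where
  open Structure M using (Carrier; d; dᵢ)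

  lookup-evalₜₛ : ∀ {m n} (σ : Vec (Term S n) m) a i →
                  lookup (evalₜₛ M σ a) i ≡ evalₜ M (lookup σ i) a
  lookup-evalₜₛ (t ∷ σ) a zero    = refl
  lookup-evalₜₛ (t ∷ σ) a (suc i) = lookup-evalₜₛ σ a i

  mutual
    evalₜ-[] : ∀ {m n} (t : Term S m) (σ : Vec (Term S n) m) a →
               evalₜ M (t [ σ ]ₜ) a ≡ evalₜ M t (evalₜₛ M σ a)
    evalₜ-[] (var x)    σ a = sym (lookup-evalₜₛ σ a x)
    evalₜ-[] (con c)    σ a = refl
    evalₜ-[] (fun f ts) σ a = cong (Structure.fun M f) (evalₜₛ-[] ts σ a)

    evalₜₛ-[] : ∀ {m n k} (ts : Vec (Term S m) k) (σ : Vec (Term S n) m) a →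
                evalₜₛ M (ts [ σ ]ₜₛ) a ≡ evalₜₛ M ts (evalₜₛ M σ a)
    evalₜₛ-[] []       σ a = refl
    evalₜₛ-[] (t ∷ ts) σ a = cong₂ _∷_ (evalₜ-[] t σ a) (evalₜₛ-[] ts σ a)

  evalₜₛ-vars : ∀ {m n} (ρ : Fin m → Fin n) a →
                evalₜₛ M (vars ρ) a ≡ tabulate (λ i → lookup a (ρ i))
  evalₜₛ-vars {zero}  ρ a = refl
  evalₜₛ-vars {suc m} ρ a = cong (lookup a (ρ zero) ∷_) (evalₜₛ-vars (λ i → ρ (suc i)) a)

  evalₜₛ-lift : ∀ {m n} (σ : Vec (Term S n) m) x a →
                evalₜₛ M (lift σ) (x ∷ a) ≡ x ∷ evalₜₛ M σ a
  evalₜₛ-lift σ x a = cong (x ∷_) (trans (evalₜₛ-[] σ (vars suc) (x ∷ a))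
    (cong (evalₜₛ M σ) (trans (evalₜₛ-vars suc (x ∷ a)) (Vecₚ.tabulate∘lookup a))))

  -- Stated with `_≃_`, since an equality between suprema would call for function extensionality.
  eval-[] : ∀ {m n} (φ : Formula S m) (σ : Vec (Term S n) m) a →
            real (eval M (φ [ σ ]) a) ≃ real (eval M φ (evalₜₛ M σ a))
  eval-[] (dist s t) σ a = subst₂ (λ x y → lhs ≃ Structure.d M x y)
    (evalₜ-[] s σ a) (evalₜ-[] t σ a) (≃-refl lhs)
    where lhs = Structure.d M (evalₜ M (s [ σ ]ₜ) a) (evalₜ M (t [ σ ]ₜ) a)
  eval-[] (rel P ts) σ a = subst (λ x → lhs ≃ real (Structure.rel M P x))
    (evalₜₛ-[] ts σ a) (≃-refl lhs)
    where lhs = real (Structure.rel M P (evalₜₛ M (ts [ σ ]ₜₛ) a))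
  eval-[] (const q)  σ a = ≃-refl (fromℚ (ℚ[0,1].value q))
  eval-[] (φ ⇒ ψ)    σ a =
    let φ≤ , φ≥ = eval-[] φ σ a
        ψ≤ , ψ≥ = eval-[] ψ σ a
        x = eval M (φ [ σ ]) a ; x′ = eval M φ (evalₜₛ M σ a)
        y = eval M (ψ [ σ ]) a ; y′ = eval M ψ (evalₜₛ M σ a)
    in ⇒-mono x x′ y y′ φ≥ ψ≤ , ⇒-mono x′ x y′ y φ≤ ψ≥
  eval-[] (sup φ)    σ a =
    (λ (x , p∈) → x , proj₁ (body x) p∈) , (λ (x , p∈) → x , proj₂ (body x) p∈)
    where
    body : ∀ x → real (eval M (φ [ lift σ ]) (x ∷ a)) ≃
                 real (eval M φ (x ∷ evalₜₛ M σ a))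
    body x = subst (λ z → real (eval M (φ [ lift σ ]) (x ∷ a)) ≃ real (eval M φ z))
      (evalₜₛ-lift σ x a) (eval-[] φ (lift σ) (x ∷ a))
  eval-[] (supω φ)   σ a =
    (λ (i , p∈) → i , proj₁ (eval-[] (φ i) σ a) p∈) ,
    (λ (i , p∈) → i , proj₂ (eval-[] (φ i) σ a) p∈)

  sups-≥ : ∀ m {n} (φ : Formula S (m ℕ.+ n)) (b : Vec Carrier m) (a : Vec Carrier n) →
           real (eval M φ (b Vec.++ a)) ≤ real (eval M (sups m φ) a)
  sups-≥ zero    φ []      a p∈ = p∈
  sups-≥ (suc m) φ (x ∷ b) a p∈ = sups-≥ m (sup φ) b a (x , p∈)

  -- The tuple b itself serves as the value of the bound variables, at which every conjunct has
  -- value 1.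
  near-top : ∀ δ {n} (σ : Formula S n) (b a : Vec Carrier n) →
             (∀ i → val δ ∉ lower (d (lookup a i) (lookup b i))) →
             1ℝ ≤ real (eval M σ b) → 1ℝ ≤ real (eval M (near δ σ) a)
  near-top δ {n} σ b a a-b 1≤σ p<1 = sups-≥ n _ b a (go (List.allFin n) p<1)
    where
    go : ∀ is → 1ℝ ≤ real (eval M (List.foldr _∧_ (σ [ vars (_↑ˡ n) ])
           (List.map (λ i → dist (var (n ↑ʳ i)) (var (i ↑ˡ n)) ⇒ const (closed δ)) is))
           (b Vec.++ a))
    go [] p<1 = proj₂ (eval-[] σ (vars (_↑ˡ n)) (b Vec.++ a))
      (subst (λ c → _ ∈ lower (real (eval M σ c))) (sym vars-b) (1≤σ p<1))
      where
      vars-b : evalₜₛ M (vars (_↑ˡ n)) (b Vec.++ a) ≡ b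
      vars-b = trans (evalₜₛ-vars (_↑ˡ n) (b Vec.++ a))
        (trans (Vecₚ.tabulate-cong (Vecₚ.lookup-++ˡ b a)) (Vecₚ.tabulate∘lookup b))
    go (i ∷ is) = ∧-top
      (dᵢ (lookup (b Vec.++ a) (n ↑ʳ i)) (lookup (b Vec.++ a) (i ↑ˡ n)) ⇒ᵢ
        fromℚ[0,1] (closed δ))
      (eval M (List.foldr _∧_ (σ [ vars (_↑ˡ n) ])
        (List.map (λ i → dist (var (n ↑ʳ i)) (var (i ↑ˡ n)) ⇒ const (closed δ)) is))
        (b Vec.++ a))
      (⇒-top (dᵢ (lookup (b Vec.++ a) (n ↑ʳ i)) (lookup (b Vec.++ a) (i ↑ˡ n)))
        (fromℚ[0,1] (closed δ))
        (subst₂ (λ x y → val δ ∉ lower (d x y))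
          (sym (Vecₚ.lookup-++ʳ b a i)) (sym (Vecₚ.lookup-++ˡ b a i)) (a-b i))
        (λ p<δ → p<δ))
      (go is)

-- Distances through rational bounds

module MetricProperties (X : MetricSpace) where
  open MetricSpace X
  open IsGeneralMetric isGeneralMetric using (≈⇒0; triangle; module EqC)
    renaming (sym to d-sym)

  d-refl : ∀ x → d x x ≤ 0ℝ
  d-refl x = proj₁ (≈⇒0 EqC.refl)

  d-sym-≤ : ∀ x y → d x y ≤ d y x
  d-sym-≤ x y = proj₁ (d-sym x y)

  d-triangle : ∀ x y z {q r} → q ∉ lower (d x y) → r ∉ lower (d y z) →
               q ℚ.+ r ∉ lower (d x z)
  d-triangle x y z q∉ r∉ q+r∈ =
    let a , b , a∈ , b∈ , q+r<a+b = triangle x y z q+r∈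
    in ℚₚ.<-asym q+r<a+b (ℚₚ.+-mono-< (∈-∉⇒< (d x y) a∈ q∉) (∈-∉⇒< (d y z) b∈ r∉))

  d-refl-∉ : ∀ x {q} → 0ℚ ℚ.≤ q → q ∉ lower (d x x)
  d-refl-∉ x 0≤q q∈ = ℚₚ.<-irrefl refl (ℚₚ.≤-<-trans 0≤q (d-refl x q∈))

  dⁿ-refl-∉ : ∀ {n} (a : Vec Carrier n) {q} → 0ℚ ℚ.≤ q → q ∉ lower (dⁿ a a)
  dⁿ-refl-∉ []      0≤q q<0 = ℚₚ.<-irrefl refl (ℚₚ.≤-<-trans 0≤q q<0)
  dⁿ-refl-∉ (x ∷ a) 0≤q     = [ d-refl-∉ x 0≤q , dⁿ-refl-∉ a 0≤q ]′

∉-of-< : ∀ x {q} → x < fromℚ q → q ∉ lower x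
∉-of-< x (p , p<q , p∉) q∈ = p∉ (downward x p<q q∈)

∉-of-≤ : ∀ x {q} → x ≤ fromℚ q → q ∉ lower x
∉-of-≤ x x≤q q∈ = ℚₚ.<-irrefl refl (x≤q q∈)

-- Finite tuples of names

upto : ∀ n → Vec ℕ n
upto n = tabulate toℕ

above : ∀ {n} → Vec ℕ n → ℕ
above []      = 0
above (i ∷ ρ) = suc i ℕ.⊔ above ρ

map-agree : ∀ {C : Set} {n} (ν ν′ : ℕ → C) (ρ : Vec ℕ n) K → above ρ ℕ.≤ K →
            (∀ i → i ℕ.< K → ν i ≡ ν′ i) → Vec.map ν ρ ≡ Vec.map ν′ ρ
map-agree ν ν′ []      K _  agree = refl
map-agree ν ν′ (i ∷ ρ) K ≤K agree = cong₂ _∷_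
  (agree i (ℕₚ.≤-trans (ℕₚ.m≤m⊔n (suc i) (above ρ)) ≤K))
  (map-agree ν ν′ ρ K (ℕₚ.≤-trans (ℕₚ.m≤n⊔m (suc i) (above ρ)) ≤K) agree)

update : {C : Set} → (ℕ → C) → ℕ → C → ℕ → C
update ν i x j with j ℕₚ.≟ i
... | yes _ = x
... | no  _ = ν j

update-≡ : ∀ {C : Set} (ν : ℕ → C) i x → update ν i x i ≡ x
update-≡ ν i x with i ℕₚ.≟ i
... | yes _   = refl
... | no  i≢i = contradiction refl i≢i

update-< : ∀ {C : Set} (ν : ℕ → C) i x j → j ℕ.< i → ν j ≡ update ν i x j
update-< ν i x j j<i with j ℕₚ.≟ i
... | yes refl = contradiction j<i (ℕₚ.<-irrefl refl)
... | no  _    = refl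

-- Indices beyond K are sent to K.
clamp : ∀ K → ℕ → Fin (suc K)
clamp K       zero    = zero
clamp zero    (suc i) = zero
clamp (suc K) (suc i) = suc (clamp K i)

toℕ-clamp : ∀ K i → i ℕ.≤ K → toℕ (clamp K i) ≡ i
toℕ-clamp K       zero    _            = refl
toℕ-clamp (suc K) (suc i) (ℕ.s≤s i≤K) = cong suc (toℕ-clamp K i i≤K)

-- A world assigns a value to every name, so a finite tuple must be continued; the length `suc K`
-- guarantees an entry to repeat.
extend : ∀ {C : Set} {K} → Vec C (suc K) → ℕ → C
extend {K = K} b i = lookup b (clamp K i)

extend-upto : ∀ {C : Set} K (ν : ℕ → C) i → i ℕ.≤ K →
              ν i ≡ extend (Vec.map ν (upto (suc K))) i
extend-upto K ν i i≤K = sym (trans (Vecₚ.lookup-map (clamp K i) ν (upto (suc K)))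
  (cong ν (trans (Vecₚ.lookup∘tabulate toℕ (clamp K i)) (toℕ-clamp K i i≤K))))

module _ {S : Signature} where

  clampedVars : ∀ K {n} → Vec ℕ n → Vec (Term S (suc K)) n
  clampedVars K = Vec.map (λ i → var (clamp K i))

  evalₜₛ-clampedVars : ∀ (M : Structure S) K {n} (ρ : Vec ℕ n) b →
    evalₜₛ M (clampedVars K ρ) b ≡ Vec.map (extend b) ρ
  evalₜₛ-clampedVars M K []      b = refl
  evalₜₛ-clampedVars M K (i ∷ ρ) b = cong (_ ∷_) (evalₜₛ-clampedVars M K ρ b)

  -- Tuples of terms are coded as formulas, so that the enumeration of L also
  -- enumerates tuples.
  decode : ∀ {n} k → Formula S n → Maybe (Vec (Term S n) k)
  decode zero    _              = just []
  decode (suc k) (dist t _ ⇒ ψ) with decode k ψ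
  ... | just ts = just (t ∷ ts)
  ... | nothing = nothing
  decode (suc k) _              = nothing

  encode : ∀ {n k} → Vec (Term S n) k → Formula S n
  encode []       = const ⟨ 0ℚ , ℚₚ.≤-refl , ℚₚ.<⇒≤ 0<1 ⟩
  encode (t ∷ ts) = dist t t ⇒ encode ts

  decode-encode : ∀ {n k} (ts : Vec (Term S n) k) → decode k (encode ts) ≡ just ts
  decode-encode []       = refl
  decode-encode (t ∷ ts) rewrite decode-encode ts = refl

-- Enumerations

record Enumeration (A : Set) : Set where
  field
    enum       : ℕ → A
    surjective : ∀ a → ∃[ i ] enum i ≡ a

open Enumeration

next : ℕ × ℕ → ℕ × ℕ
next (zero  , j) = suc j , 0
next (suc i , j) = i , suc j

ℕ×ℕ-enumeration : Enumeration (ℕ × ℕ)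
ℕ×ℕ-enumeration = record { enum = diagonal ; surjective = λ (i , j) → surj (i ℕ.+ j) i j refl }
  where
  diagonal : ℕ → ℕ × ℕ
  diagonal zero    = 0 , 0
  diagonal (suc n) = next (diagonal n)
  -- The number s of the antidiagonal is explicit to make the recursion structural: j decreases
  -- along a diagonal, and from j = 0 the predecessor is the end of the previous diagonal.
  surj : ∀ s i j → i ℕ.+ j ≡ s → ∃[ n ] diagonal n ≡ (i , j)
  surj s i (suc j) i+1+j≡s =
    let n , eq = surj s (suc i) j (trans (sym (ℕₚ.+-suc i j)) i+1+j≡s)
    in suc n , cong next eq
  surj zero    zero    zero _    = 0 , refl
  surj (suc s) (suc i) zero refl =
    let n , eq = surj (i ℕ.+ 0) zero (i ℕ.+ 0) refl
    in suc n , trans (cong next eq) (cong (λ k → suc k , 0) (ℕₚ.+-identityʳ i))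

×-enumeration : ∀ {A B} → Enumeration A → Enumeration B → Enumeration (A × B)
×-enumeration A B = record
  { enum       = λ n → let i , j = enum ℕ×ℕ-enumeration n in enum A i , enum B j
  ; surjective = λ (a , b) →
      let i , i↦a = surjective A a
          j , j↦b = surjective B b
          n , n↦ij = surjective ℕ×ℕ-enumeration (i , j)
      in n , trans (cong (λ (i , j) → enum A i , enum B j) n↦ij) (cong₂ _,_ i↦a j↦b)
  }

ℕ-enumeration : Enumeration ℕ
ℕ-enumeration = record { enum = λ n → n ; surjective = λ n → n , refl }

ℚ-enumeration : Enumeration ℚ
ℚ-enumeration = record
  { enum       = λ n → fraction (enum codes n)
  ; surjective = λ q →
      let c , c↦q = surj q ; n , n↦c = surjective codes c
      in n , trans (cong fraction n↦c) c↦q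
  }
  where
  codes = ×-enumeration ℕ×ℕ-enumeration ℕ-enumeration
  fraction : (ℕ × ℕ) × ℕ → ℚ
  fraction ((i , j) , d) = (i ℤ.⊖ j) ℚ./ suc d
  surj : ∀ q → ∃[ c ] fraction c ≡ q
  surj q@(ℚ.mkℚ (ℤ.+ i)      d _) = ((i , 0) , d) , ℚₚ.↥p/↧p≡p q
  surj q@(ℚ.mkℚ (ℤ.-[1+ i ]) d _) = ((0 , suc i) , d) , ℚₚ.↥p/↧p≡p q

-- Worlds, conditions and requirements

module Forcing (em : ∀ ℓ → ExcludedMiddle ℓ) {S : Signature}
  (L : (n : ℕ) → Pred (Formula S n) 0ℓ) (L-fragment : IsFragment L)
  (T : Pred (Formula S 0) 0ℓ) where

  open Classical em
  open IsFragment L-fragment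

  record World : Set₁ where
    constructor world
    field
      model  : Structure S
      models : model ⊨* T
      assign : ℕ → Structure.Carrier model

    tuple : ∀ {n} → Vec ℕ n → Vec (Structure.Carrier model) n
    tuple = Vec.map assign

    value : ∀ {n} → Formula S n → Vec (Structure.Carrier model) n → 𝕀
    value = eval model

  open World

  -- Membership in `L` is carried along because a merged condition must again be a formula of `L`.
  record Constraint : Set where
    constructor constraint
    field
      {arity} : ℕ
      formula : Formula S arity
      ∈L      : formula ∈ L arity
      indices : Vec ℕ arity
      bound   : ℚ

  open Constraint

  Condition : Set
  Condition = List Constraint

  Holds : World → Constraint → Set
  Holds w c = bound c ∈ lower (real (value w (formula c) (tuple w (indices c))))

  infix 4 _⊩_
  _⊩_ : World → Condition → Set
  w ⊩ p = All (Holds w) p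

  fresh : Condition → ℕ
  fresh []      = 0
  fresh (c ∷ p) = above (indices c) ℕ.⊔ fresh p

  ⊩-update : ∀ (M : Structure S) (models : M ⊨* T) ν p i x → fresh p ℕ.≤ i →
             world M models ν ⊩ p → world M models (update ν i x) ⊩ p
  ⊩-update M models ν []      i x _       []       = []
  ⊩-update M models ν (c ∷ p) i x fresh≤i (h ∷ hs) =
    subst (λ a → bound c ∈ lower (real (eval M (formula c) a)))
      (map-agree ν (update ν i x) (indices c) i
        (ℕₚ.≤-trans (ℕₚ.m≤m⊔n (above (indices c)) (fresh p)) fresh≤i)
        (update-< ν i x)) h
    ∷ ⊩-update M models ν p i x (ℕₚ.≤-trans (ℕₚ.m≤n⊔m (above (indices c)) (fresh p)) fresh≤i) hs

  -- A condition fulfils a requirement if it excludes the trigger or forces an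
  -- outcome, so each requirement needs to be treated only once along a chain.
  record Requirement : Set₁ where
    field
      Trigger : World → Set
      Index   : Set
      Outcome : Index → World → Set
      reachable : ∀ p w → w ⊩ p → Trigger w →
                ∃[ i ] ∃[ c ] (Σ[ w′ ∈ World ] w′ ⊩ c ++ p) ×
                              (∀ v → v ⊩ c → Outcome i v)

  Fulfilled : Requirement → Condition → Set₁
  Fulfilled R p = (∀ w → w ⊩ p → ¬ Trigger w) ⊎ (∃[ i ] ∀ w → w ⊩ p → Outcome i w)
    where open Requirement R

  -- The world that keeps p satisfiable may be exchanged: if some world of p triggers R, the
  -- extension starts from that one.
  meet : ∀ R p → (Σ[ w ∈ World ] w ⊩ p) →
         Σ[ p′ ∈ Condition ] (Σ[ w ∈ World ] w ⊩ p′) × (∀ w → w ⊩ p′ → w ⊩ p) × Fulfilled R p′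
  meet R p (w , w⊩p) with em _ {Σ[ v ∈ World ] v ⊩ p × Requirement.Trigger R v}
  ... | no ¬triggered = p , (w , w⊩p) , (λ _ v⊩p → v⊩p) ,
                        inj₁ (λ v v⊩p t → ¬triggered (v , v⊩p , t))
  ... | yes (v , v⊩p , t) =
    let i , c , sat , out = Requirement.reachable R p v v⊩p t
    in c ++ p , sat , (λ u u⊩ → Allₚ.++⁻ʳ c u⊩) , inj₂ (i , λ u u⊩ → out u (Allₚ.++⁻ˡ c u⊩))

  trivial : Requirement
  trivial = record { Trigger = λ _ → ⊥ ; Index = ⊥ ; Outcome = λ () ; reachable = λ _ _ _ () }

  -- If q < φ fails in w, then φ ≤ q < q′ there, and φ < q′ is expressible by a constraint although
  -- φ ≤ q is not. The trigger asks for membership in `L` because the enumeration may also list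
  -- formulas outside `L`.
  decideReq : ∀ n → Formula S n → ℚ → ℚ → Requirement
  decideReq n φ q q′ = record
    { Trigger = λ _ → φ ∈ L n × q ℚ.< q′
    ; Index   = Bool
    ; Outcome = out
    ; reachable = reach
    }
    where
    out : Bool → World → Set
    out true  w = q ∈ lower (real (value w φ (tuple w (upto n))))
    out false w = q′ ∉ lower (real (value w φ (tuple w (upto n))))
    reach : ∀ p w → w ⊩ p → φ ∈ L n × q ℚ.< q′ →
      ∃[ i ] ∃[ c ] (Σ[ w′ ∈ World ] w′ ⊩ c ++ p) × (∀ v → v ⊩ c → out i v)
    reach p w w⊩p (φ∈L , q<q′) with em _ {q ∈ lower (real (value w φ (tuple w (upto n))))}
    ... | yes q∈ = true , constraint φ φ∈L (upto n) q ∷ [] , (w , q∈ ∷ w⊩p) ,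
                   λ { v (h ∷ []) → h }
    ... | no q∉ = false , constraint (~ φ) (~-∈ φ∈L) (upto n) (1ℚ ℚ.- q′) ∷ [] ,
                  (w , ¬ᵢ-intro (value w φ (tuple w (upto n))) q∉ q<q′ ∷ w⊩p) ,
                  λ { v (h ∷ []) →
                        let x = value v φ (tuple v (upto n))
                            t , t∉ , t<q′ = ¬ᵢ-elim x h
                        in ∉-upward (real x) (ℚₚ.<⇒≤ t<q′) t∉ }

  -- Henkin witnesses: rational bounds for an implication, a fresh name for `sup`, an index for
  -- `supω`.
  witnessReq : ∀ n → Formula S n → ℚ → Requirement
  witnessReq n (φ ⇒ ψ) p = record
    { Trigger = λ w → (φ ⇒ ψ) ∈ L n × p ∈ lower (real (value w (φ ⇒ ψ) (tuple w (upto n))))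
    ; Index   = ∃[ s ] ∃[ t ] p ℚ.< 1ℚ ℚ.- t ℚ.+ s
    ; Outcome = λ (s , t , _) w → s ∈ lower (real (value w ψ (tuple w (upto n)))) ×
                                  t ∉ lower (real (value w φ (tuple w (upto n))))
    ; reachable = λ c w w⊩c (⇒∈L , p∈) →
        let x = value w φ (tuple w (upto n)) ; y = value w ψ (tuple w (upto n))
            s , t , s∈y , t∉x , p<1-t+s = ⇒-elim x y p∈
            -- The bound φ ≤ t is weakened to φ < t′ to become a constraint, with t′ small enough to
            -- keep p < 1 - t′ + s.
            t′ , t<t′ , t′<1+s-p = dense {t} {1ℚ ℚ.+ s ℚ.- p}
              (<-by p<1-t+s (solve 3 (λ p s t →
                 t :+ (:con 1ℚ :- t :+ s) := :con 1ℚ :+ s :- p :+ p) refl p s t))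
        in (s , t′ , <-by t′<1+s-p (solve 3 (λ p s t →
              p :+ (:con 1ℚ :+ s :- p) := :con 1ℚ :- t :+ s :+ t) refl p s t′)) ,
           constraint ψ (⇒-subʳ ⇒∈L) (upto n) s ∷
             constraint (~ φ) (~-∈ (⇒-subˡ ⇒∈L)) (upto n) (1ℚ ℚ.- t′) ∷ [] ,
           (w , s∈y ∷ ¬ᵢ-intro x t∉x t<t′ ∷ w⊩c) ,
           λ { v (s∈ ∷ h ∷ []) →
                 let x′ = value v φ (tuple v (upto n))
                     u , u∉ , u<t′ = ¬ᵢ-elim x′ h
                 in s∈ , ∉-upward (real x′) (ℚₚ.<⇒≤ u<t′) u∉ }
    }
  witnessReq n (sup φ) p = record
    { Trigger = λ w → sup φ ∈ L n × p ∈ lower (real (value w (sup φ) (tuple w (upto n))))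
    ; Index   = ℕ
    ; Outcome = λ i w → p ∈ lower (real (value w φ (assign w i ∷ tuple w (upto n))))
    ; reachable = λ { c (world M models ν) w⊩c (sup∈L , x , p∈) →
        -- The new name must differ from the parameters of φ as well as from the names in the
        -- condition.
        let i = fresh c ℕ.⊔ above (upto n)
            ν′ = update ν i x
        in i , constraint φ (sup-sub sup∈L) (i ∷ upto n) p ∷ [] ,
           (world M models ν′ ,
             subst (λ a → p ∈ lower (real (eval M φ a)))
               (cong₂ _∷_ (sym (update-≡ ν i x))
                 (map-agree ν ν′ (upto n) i (ℕₚ.m≤n⊔m (fresh c) (above (upto n)))
                   (update-< ν i x)))
               p∈
             ∷ ⊩-update M models ν c i x (ℕₚ.m≤m⊔n (fresh c) (above (upto n))) w⊩c) ,
           λ { v (h ∷ []) → h } }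
    }
  witnessReq n (supω φ) p = record
    { Trigger = λ w → supω φ ∈ L n × p ∈ lower (real (value w (supω φ) (tuple w (upto n))))
    ; Index   = ℕ
    ; Outcome = λ i w → p ∈ lower (real (value w (φ i) (tuple w (upto n))))
    ; reachable = λ c w w⊩c (supω∈L , i , p∈) →
        i , constraint (φ i) (supω-sub supω∈L i) (upto n) p ∷ [] , (w , p∈ ∷ w⊩c) ,
        λ { v (h ∷ []) → h }
    }
  witnessReq n _ _ = trivial

  -- Merging conditions and omitting types

  -- A condition is merged into a single formula, as needed to contradict
  -- non-principality: ψ has value 1 in w, and ψ > r implies p in every model of T.
  Approximation : ∀ K → World → Condition → Set₁
  Approximation K w p = Σ[ ψ ∈ Formula S (suc K) ] ψ ∈ L (suc K) ×
    1ℝ ≤ real (value w ψ (tuple w (upto (suc K)))) ×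
    Σ[ r ∈ ℚ ] r ℚ.< 1ℚ ×
      ((M : Structure S) (models : M ⊨* T) → ∀ b →
        r ∈ lower (real (eval M ψ b)) → world M models (extend b) ⊩ p)

  -- A strict bound leaves room for q < q′ < φ. Then q′ → φ has value 1 in w, while a value above 1
  -- - (q′ - q) in any model gives back q < φ.
  approximateᶜ : ∀ K w c → above (indices c) ℕ.≤ K → Holds w c → Approximation K w (c ∷ [])
  approximateᶜ K w (constraint φ φ∈L ρ q) above≤K q∈ with q ℚₚ.<? 0ℚ
  -- A negative bound holds in every world; it is split off because q′ could then be negative and no
  -- constant of the logic.
  ... | yes q<0 = const ⟨ 1ℚ , ℚₚ.<⇒≤ 0<1 , ℚₚ.≤-refl ⟩ , const-∈ _ , (λ p<1 → p<1) ,
                  0ℚ , 0<1 , λ M _ b _ → 𝕀.0≤ (eval M φ (Vec.map (extend b) ρ)) q<0 ∷ []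
  ... | no  q≮0 =
    const v ⇒ φ [ clampedVars K ρ ] , ⇒-∈ (const-∈ v) ([]-∈ (clampedVars K ρ) φ∈L) ,
    ⇒-top (fromℚ[0,1] v) (value w (φ [ clampedVars K ρ ]) (tuple w (upto (suc K))))
      (ℚₚ.<-irrefl refl)
      (λ p<q′ → proj₂ (eval-[] M φ (clampedVars K ρ) (tuple w (upto (suc K))))
        (subst (λ a → _ ∈ lower (real (eval M φ a))) tuple≡ (downward x p<q′ q′∈))) ,
    1ℚ ℚ.- (q′ ℚ.- q) ,
    <-by q<q′ (solve 2 (λ q q′ → :con 1ℚ :- (q′ :- q) :+ q′ := :con 1ℚ :+ q) refl q q′) ,
    λ M′ models b r∈ → subst (λ a → q ∈ lower (real (eval M′ φ a)))
      (evalₜₛ-clampedVars M′ K ρ b)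
      (proj₁ (eval-[] M′ φ (clampedVars K ρ) b)
        (const⇒-elim v (eval M′ (φ [ clampedVars K ρ ]) b)
          (ℚₚ.≤-reflexive (solve 2 (λ q q′ →
             q := q′ :+ (:con 1ℚ :- (q′ :- q)) :- :con 1ℚ) refl q q′)) r∈))
      ∷ []
    where
    open Substitution
    M = model w
    x = real (value w φ (tuple w ρ))
    q′ = proj₁ (rounded x q∈)
    q<q′ = proj₁ (proj₂ (rounded x q∈))
    q′∈ = proj₂ (proj₂ (rounded x q∈))
    v : ℚ[0,1]
    v = ⟨ q′ , ℚₚ.≤-trans (ℚₚ.≮⇒≥ q≮0) (ℚₚ.<⇒≤ q<q′) ,
          ℚₚ.<⇒≤ (𝕀.≤1 (value w φ (tuple w ρ)) q′∈) ⟩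
    tuple≡ : tuple w ρ ≡ evalₜₛ M (clampedVars K ρ) (tuple w (upto (suc K)))
    tuple≡ = trans
      (map-agree (assign w) (extend (tuple w (upto (suc K)))) ρ K above≤K
        (λ i i<K → extend-upto K (assign w) i (ℕₚ.<⇒≤ i<K)))
      (sym (evalₜₛ-clampedVars M K ρ (tuple w (upto (suc K)))))

  approximate : ∀ K w p → fresh p ℕ.≤ K → w ⊩ p → Approximation K w p
  approximate K w []      _       []       =
    const ⟨ 1ℚ , ℚₚ.<⇒≤ 0<1 , ℚₚ.≤-refl ⟩ , const-∈ _ , (λ p<1 → p<1) ,
    0ℚ , 0<1 , λ _ _ _ _ → []
  approximate K w (c ∷ p) fresh≤K (h ∷ hs)
    with approximateᶜ K w c (ℕₚ.≤-trans (ℕₚ.m≤m⊔n (above (indices c)) (fresh p)) fresh≤K) h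
       | approximate K w p (ℕₚ.≤-trans (ℕₚ.m≤n⊔m (above (indices c)) (fresh p)) fresh≤K) hs
  ... | φ , φ∈L , φ-top , r , r<1 , φ-out | ψ , ψ∈L , ψ-top , s , s<1 , ψ-out =
    ~ (φ ⇒ ~ ψ) , ~-∈ (⇒-∈ φ∈L (~-∈ ψ∈L)) ,
    ⊗-top (value w φ (tuple w (upto (suc K)))) (value w ψ (tuple w (upto (suc K))))
      φ-top ψ-top ,
    r ℚ.⊔ s , ⊔-< ,
    λ M models b r⊔s∈ →
      let x = eval M φ b ; y = eval M ψ b in
      All.head (φ-out M models b
        (∈-downward (real x) (ℚₚ.p≤p⊔q r s) (⊗-elimˡ x y r⊔s∈)))
      ∷ ψ-out M models b (∈-downward (real y) (ℚₚ.p≤q⊔p r s) (⊗-elimʳ x y r⊔s∈))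
    where
    ⊔-< : r ℚ.⊔ s ℚ.< 1ℚ
    ⊔-< with ℚₚ.⊔-sel r s
    ... | inj₁ ≡r = subst (ℚ._< 1ℚ) (sym ≡r) r<1
    ... | inj₂ ≡s = subst (ℚ._< 1ℚ) (sym ≡s) s<1

  omitReq : ∀ {k} (Ψ : Pred (Formula S k) 0ℓ) → Ψ ⊆ L k → ¬ Principal L T Ψ →
            ∀ N → Vec (Term S N) k → Requirement
  omitReq {k} Ψ Ψ⊆L ¬principal N ts = record
    { Trigger = λ _ → ⊤
    ; Index   = ∃[ σ ] σ ∈ Ψ × ∃[ q ] q ℚ.< 1ℚ
    ; Outcome = λ (σ , _ , q , _) w →
        q ∉ lower (real (value w σ (evalₜₛ (model w) ts (tuple w (upto N)))))
    ; reachable = reach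
    }
    where
    open Substitution
    Outcome : ∃[ σ ] σ ∈ Ψ × (∃[ q ] q ℚ.< 1ℚ) → World → Set
    Outcome (σ , _ , q , _) w =
      q ∉ lower (real (value w σ (evalₜₛ (model w) ts (tuple w (upto N)))))
    reach : ∀ p w → w ⊩ p → ⊤ →
      ∃[ i ] ∃[ c ] (Σ[ w′ ∈ World ] w′ ⊩ c ++ p) × (∀ v → v ⊩ c → Outcome i v)
    reach p w w⊩p _ with em _ {Σ[ v ∈ World ] v ⊩ p × ∃[ i ] Outcome i v}
    ... | yes (v , v⊩p , (σ , σ∈Ψ , q , q<1) , q∉) =
      -- Again σ ≤ q is weakened to σ < q′, still with q′ < 1, so as to become a constraint.
      let q′ , q<q′ , q′<1 = dense q<1
          x = value v (σ [ ts ]) (tuple v (upto N))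
      in (σ , σ∈Ψ , q′ , q′<1) ,
         constraint (~ (σ [ ts ])) (~-∈ ([]-∈ ts (Ψ⊆L σ∈Ψ))) (upto N) (1ℚ ℚ.- q′) ∷ [] ,
         (v , ¬ᵢ-intro x (λ q∈ → q∉ (proj₁ (eval-[] (model v) σ ts (tuple v (upto N))) q∈))
                q<q′ ∷ v⊩p) ,
         λ { u (h ∷ []) q′∈ →
               let y = value u (σ [ ts ]) (tuple u (upto N))
                   t , t∉ , t<q′ = ¬ᵢ-elim y h
               in t∉ (downward (real y) t<q′
                    (proj₂ (eval-[] (model u) σ ts (tuple u (upto N))) q′∈)) }
    ... | no ¬out = contradiction principal ¬principal
      where
      K = fresh p
      principal : Principal L T Ψ
      principal with approximate K w p ℕₚ.≤-refl w⊩p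
      ... | ψ , ψ∈L , ψ-top , r , r<1 , ψ-out =
        let r⊔0<1 = [ (λ e → subst (ℚ._< 1ℚ) (sym e) r<1) ,
                      (λ e → subst (ℚ._< 1ℚ) (sym e) 0<1) ]′ (ℚₚ.⊔-sel r 0ℚ)
            -- The maximum with 0 brings the threshold into (0,1). It must also exceed r, since
            -- principality assumes s ≤ ψ whereas the approximation asks for r < ψ.
            s , r⊔0<s , s<1 = dense r⊔0<1
        -- All names in p are below K, while `ts` may mention others, which clamping identifies with
        -- the spare name K. This is harmless as `¬out` covers every world of p.
        in suc K , ψ , ts [ clampedVars K (upto N) ]ₜₛ ,
           ⟨ s , ℚₚ.≤-<-trans (ℚₚ.p≤q⊔p r 0ℚ) r⊔0<s , s<1 ⟩ , ψ∈L ,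
           (model w , models w , tuple w (upto (suc K)) ,
             ≃1 (value w ψ (tuple w (upto (suc K)))) ψ-top) ,
           λ M models b s≤ψ {σ} σ∈Ψ →
             ≃1 (eval M σ (evalₜₛ M (ts [ clampedVars K (upto N) ]ₜₛ) b)) λ {q} q<1 →
               dne λ q∉ → ¬out
                 ( world M models (extend b)
                 , ψ-out M models b (s≤ψ (ℚₚ.≤-<-trans (ℚₚ.p≤p⊔q r 0ℚ) r⊔0<s))
                 , (σ , σ∈Ψ , q , q<1)
                 , subst (λ a → q ∉ lower (real (eval M σ a)))
                     (trans (evalₜₛ-[] M ts (clampedVars K (upto N)) b)
                       (cong (evalₜₛ M ts) (evalₜₛ-clampedVars M K (upto N) b)))
                     q∉ )

-- The generic chain

module Generic (em : ∀ ℓ → ExcludedMiddle ℓ) {S : Signature}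
  (L : (n : ℕ) → Pred (Formula S n) 0ℓ) (L-fragment : IsFragment L) (L-countable : IsCountable L)
  (T : Pred (Formula S 0) 0ℓ) (T-satisfiable : Satisfiable T)
  (k : ℕ → ℕ) (Ψ : (n : ℕ) → Pred (Formula S (k n)) 0ℓ) (Ψ⊆L : ∀ n → Ψ n ⊆ L (k n))
  (Ψ-nonprincipal : ∀ n → ¬ Principal L T (Ψ n)) where

  open Signature S
  open Classical em
  open Forcing em L L-fragment T
  open World
  open Requirement
  open IsFragment L-fragment
  open Substitution

  omitTask : ∀ n N → Maybe (Vec (Term S N) (k n)) → Requirement
  omitTask n N (just ts) = omitReq (Ψ n) (Ψ⊆L n) (Ψ-nonprincipal n) N ts
  omitTask n N nothing   = trivial

  task : ℕ → ∃ (Formula S) → ℚ → ℚ → Requirement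
  task 0             (n , φ) q q′ = decideReq n φ q q′
  task 1             (n , φ) q _  = witnessReq n φ q
  task (suc (suc n)) (N , χ) _ _  = omitTask n N (decode (k n) χ)

  tasks : Enumeration (ℕ × ℕ × ℚ × ℚ)
  tasks = ×-enumeration ℕ-enumeration
    (×-enumeration ℕ-enumeration (×-enumeration ℚ-enumeration ℚ-enumeration))

  taskAt : ℕ × ℕ × ℚ × ℚ → Requirement
  taskAt (c , i , q , q′) = task c (proj₁ L-countable i) q q′

  stage : ℕ → Σ[ p ∈ Condition ] (Σ[ w ∈ World ] w ⊩ p)
  stage zero    = [] , world (proj₁ T-satisfiable) (proj₂ T-satisfiable)
                         (λ _ → Structure.point (proj₁ T-satisfiable)) , []
  stage (suc i) =
    let p , sat = stage i
        p′ , sat′ , _ = meet (taskAt (enum tasks i)) p sat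
    in p′ , sat′

  cond : ℕ → Condition
  cond i = proj₁ (stage i)

  cond-suc : ∀ i w → w ⊩ cond (suc i) → w ⊩ cond i
  cond-suc i = let p , sat = stage i in
    proj₁ (proj₂ (proj₂ (meet (taskAt (enum tasks i)) p sat)))

  fulfilled : ∀ i → Fulfilled (taskAt (enum tasks i)) (cond (suc i))
  fulfilled i = let p , sat = stage i in
    proj₂ (proj₂ (proj₂ (meet (taskAt (enum tasks i)) p sat)))

  cond-+ : ∀ i j w → w ⊩ cond (j ℕ.+ i) → w ⊩ cond i
  cond-+ i zero    w w⊩ = w⊩
  cond-+ i (suc j) w w⊩ = cond-+ i j w (cond-suc (j ℕ.+ i) w w⊩)

  Forced : (World → Set) → Set₁
  Forced Q = ∃[ i ] ∀ w → w ⊩ cond i → Q w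

  Forced-map : ∀ {Q R : World → Set} → (∀ w → Q w → R w) → Forced Q → Forced R
  Forced-map f (i , q) = i , λ w w⊩ → f w (q w w⊩)

  Forced-∩ : ∀ {Q R : World → Set} → Forced Q → Forced R → Forced (λ w → Q w × R w)
  Forced-∩ (i , q) (j , r) = j ℕ.+ i , λ w w⊩ →
    q w (cond-+ i j w w⊩) ,
    r w (cond-+ j i w (subst (λ m → w ⊩ cond m) (ℕₚ.+-comm j i) w⊩))

  -- Consistency of forcing: each stage carries a world. With `Forced-∩`, finitely many forced facts
  -- can be compared inside one actual model.
  Forced-sat : ∀ {Q : World → Set} → Forced Q → Σ[ w ∈ World ] Q w
  Forced-sat (i , q) = let w , w⊩ = proj₂ (stage i) in w , q w w⊩

  -- It does not matter whether the task comes up before or after its trigger is forced: had its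
  -- stage excluded the trigger, a world of the later of the two conditions would be contradictory.
  resolve : ∀ c {n} {φ : Formula S n} q q′ → φ ∈ L n →
            let R = task c (n , φ) q q′ in
            Forced (Trigger R) → ∃[ j ] Forced (Outcome R j)
  resolve c {n} {φ} q q′ φ∈L trig =
    let i , i↦φ = proj₂ L-countable φ∈L
        m , m↦ = surjective tasks (c , i , q , q′)
    in go (suc m) (subst (λ χ → Fulfilled (task c χ q q′) (cond (suc m))) i↦φ
         (subst (λ t → Fulfilled (taskAt t) (cond (suc m))) m↦ (fulfilled m)))
    where
    R = task c (n , φ) q q′
    go : ∀ m → Fulfilled R (cond m) → ∃[ j ] Forced (Outcome R j)
    go m (inj₁ ¬trig)    =
      let w , t , ¬t = Forced-sat (Forced-∩ trig (m , ¬trig)) in contradiction t ¬t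
    go m (inj₂ (j , out)) = j , m , out

  -- Terms in the names

  data ωTerm : Set where
    var : ℕ → ωTerm
    con : Con → ωTerm
    fun : (f : Fun) → Vec ωTerm (arityF f) → ωTerm

  mutual
    ⟦_⟧ : ωTerm → (w : World) → Structure.Carrier (model w)
    ⟦ var i ⟧    w = assign w i
    ⟦ con c ⟧    w = Structure.con (model w) c
    ⟦ fun f ts ⟧ w = Structure.fun (model w) f (⟦ ts ⟧ₛ w)

    ⟦_⟧ₛ : ∀ {n} → Vec ωTerm n → (w : World) → Vec (Structure.Carrier (model w)) n
    ⟦ [] ⟧ₛ     w = []
    ⟦ t ∷ ts ⟧ₛ w = ⟦ t ⟧ w ∷ ⟦ ts ⟧ₛ w

  mutual
    maxIndex : ωTerm → ℕ
    maxIndex (var i)    = i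
    maxIndex (con c)    = 0
    maxIndex (fun f ts) = maxIndexₛ ts

    maxIndexₛ : ∀ {n} → Vec ωTerm n → ℕ
    maxIndexₛ []       = 0
    maxIndexₛ (t ∷ ts) = maxIndex t ℕ.⊔ maxIndexₛ ts

  mutual
    toTerm : ∀ K → ωTerm → Term S (suc K)
    toTerm K (var i)    = var (clamp K i)
    toTerm K (con c)    = con c
    toTerm K (fun f ts) = fun f (toTermₛ K ts)

    toTermₛ : ∀ K {n} → Vec ωTerm n → Vec (Term S (suc K)) n
    toTermₛ K []       = []
    toTermₛ K (t ∷ ts) = toTerm K t ∷ toTermₛ K ts

  mutual
    evalₜ-toTerm : ∀ K t w → maxIndex t ℕ.≤ K →
      evalₜ (model w) (toTerm K t) (tuple w (upto (suc K))) ≡ ⟦ t ⟧ w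
    evalₜ-toTerm K (var i)    w i≤K = sym (extend-upto K (assign w) i i≤K)
    evalₜ-toTerm K (con c)    w _   = refl
    evalₜ-toTerm K (fun f ts) w ≤K  = cong (Structure.fun (model w) f) (evalₜₛ-toTermₛ K ts w ≤K)

    evalₜₛ-toTermₛ : ∀ K {n} (ts : Vec ωTerm n) w → maxIndexₛ ts ℕ.≤ K →
      evalₜₛ (model w) (toTermₛ K ts) (tuple w (upto (suc K))) ≡ ⟦ ts ⟧ₛ w
    evalₜₛ-toTermₛ K []       w _  = refl
    evalₜₛ-toTermₛ K (t ∷ ts) w ≤K = cong₂ _∷_
      (evalₜ-toTerm K t w (ℕₚ.≤-trans (ℕₚ.m≤m⊔n (maxIndex t) (maxIndexₛ ts)) ≤K))
      (evalₜₛ-toTermₛ K ts w (ℕₚ.≤-trans (ℕₚ.m≤n⊔m (maxIndex t) (maxIndexₛ ts)) ≤K))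

  value-ω : ∀ {n} → Formula S n → Vec ωTerm n → World → 𝕀
  value-ω φ a w = value w φ (⟦ a ⟧ₛ w)

  module _ {n} (a : Vec ωTerm n) where
    private
      K = maxIndexₛ a
      σ = toTermₛ K a

      value-toTerm : ∀ φ w → real (value w (φ [ σ ]) (tuple w (upto (suc K)))) ≃
                             real (value-ω φ a w)
      value-toTerm φ w = subst
        (λ b → real (value w (φ [ σ ]) (tuple w (upto (suc K)))) ≃ real (value w φ b))
        (evalₜₛ-toTermₛ K a w ℕₚ.≤-refl)
        (eval-[] (model w) φ σ (tuple w (upto (suc K))))

      to : ∀ φ {p} w → p ∈ lower (real (value w (φ [ σ ]) (tuple w (upto (suc K))))) →
           p ∈ lower (real (value-ω φ a w))
      to φ w = proj₁ (value-toTerm φ w)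

      from : ∀ φ {p} w → p ∈ lower (real (value-ω φ a w)) →
             p ∈ lower (real (value w (φ [ σ ]) (tuple w (upto (suc K)))))
      from φ w = proj₂ (value-toTerm φ w)

    -- Requirements are stated at the names 0, ..., K. A tuple of terms is brought into this form by
    -- substituting it into φ, which stays in `L`.
    decide : ∀ {φ : Formula S n} → φ ∈ L n → ∀ {q q′} → q ℚ.< q′ →
             Forced (λ w → q ∈ lower (real (value-ω φ a w))) ⊎
             Forced (λ w → q′ ∉ lower (real (value-ω φ a w)))
    decide {φ} φ∈L {q} {q′} q<q′
      with resolve 0 q q′ ([]-∈ σ φ∈L) (0 , λ _ _ → []-∈ σ φ∈L , q<q′)
    ... | true  , ev = inj₁ (Forced-map (to φ) ev)
    ... | false , ev = inj₂ (Forced-map (λ w q′∉ q′∈ → q′∉ (from φ w q′∈)) ev)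

    witness-⇒ : ∀ {φ ψ : Formula S n} → (φ ⇒ ψ) ∈ L n → ∀ {p} →
      Forced (λ w → p ∈ lower (real (value-ω (φ ⇒ ψ) a w))) →
      ∃[ s ] ∃[ t ] p ℚ.< 1ℚ ℚ.- t ℚ.+ s ×
        Forced (λ w → s ∈ lower (real (value-ω ψ a w))) ×
        Forced (λ w → t ∉ lower (real (value-ω φ a w)))
    witness-⇒ {φ} {ψ} ⇒∈L {p} ev =
      let (s , t , p<) , ev′ = resolve 1 p p ([]-∈ σ ⇒∈L)
            (Forced-map (λ w p∈ → []-∈ σ ⇒∈L , from (φ ⇒ ψ) w p∈) ev)
      in s , t , p< , Forced-map (λ w (s∈ , _) → to ψ w s∈) ev′ ,
         Forced-map (λ w (_ , t∉) t∈ → t∉ (from φ w t∈)) ev′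

    witness-sup : ∀ {φ : Formula S (suc n)} → sup φ ∈ L n → ∀ {p} →
      Forced (λ w → p ∈ lower (real (value-ω (sup φ) a w))) →
      ∃[ u ] Forced (λ w → p ∈ lower (real (value-ω φ (u ∷ a) w)))
    witness-sup {φ} sup∈L {p} ev =
      let i , ev′ = resolve 1 p p ([]-∈ σ sup∈L)
            (Forced-map (λ w p∈ → []-∈ σ sup∈L , from (sup φ) w p∈) ev)
      in var i , Forced-map (λ w p∈ →
           let x = assign w i ; b = tuple w (upto (suc K)) in
           subst (λ c → p ∈ lower (real (value w φ c)))
             (trans (evalₜₛ-lift (model w) σ x b)
               (cong (x ∷_) (evalₜₛ-toTermₛ K a w ℕₚ.≤-refl)))
             (proj₁ (eval-[] (model w) φ (lift σ) (x ∷ b)) p∈)) ev′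

    witness-supω : ∀ {φ : ℕ → Formula S n} → supω φ ∈ L n → ∀ {p} →
      Forced (λ w → p ∈ lower (real (value-ω (supω φ) a w))) →
      ∃[ i ] Forced (λ w → p ∈ lower (real (value-ω (φ i) a w)))
    witness-supω {φ} supω∈L {p} ev =
      let i , ev′ = resolve 1 p p ([]-∈ σ supω∈L)
            (Forced-map (λ w p∈ → []-∈ σ supω∈L , from (supω φ) w p∈) ev)
      in i , Forced-map (to (φ i)) ev′

  encode-∈ : ∀ {N m} (ts : Vec (Term S N) m) → encode ts ∈ L N
  encode-∈ []       = const-∈ _
  encode-∈ (t ∷ ts) = ⇒-∈ (dist-∈ t t) (encode-∈ ts)

  forced-omit : ∀ n (a : Vec ωTerm (k n)) → ∃[ σ ] σ ∈ Ψ n × ∃[ q ] q ℚ.< 1ℚ ×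
                Forced (λ w → q ∉ lower (real (value-ω σ a w)))
  forced-omit n a =
    let (σ , σ∈Ψ , q , q<1) , ev = subst
          (λ R → Forced (Trigger R) → ∃[ j ] Forced (Outcome R j))
          (cong (omitTask n (suc K)) (decode-encode ts))
          (resolve (suc (suc n)) 0ℚ 0ℚ (encode-∈ ts)) (0 , λ _ _ → tt)
    in σ , σ∈Ψ , q , q<1 , Forced-map
         (λ w → subst (λ b → q ∉ lower (real (value w σ b)))
                  (evalₜₛ-toTermₛ K a w ℕₚ.≤-refl)) ev
    where
    K = maxIndexₛ a
    ts = toTermₛ K a

  -- Forced values

  -- Forcing quantifies over a proper class of models, but cuts are predicates in
  -- Set, so excluded middle is used to resize.
  Small : ∀ {ℓ} → Set ℓ → Set
  Small {ℓ} P = True (em ℓ {P})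

  -- Asking for some q′ > q makes the cut rounded.
  ForcedAbove : (World → 𝕀) → ℚ → Set₁
  ForcedAbove O q = ∃[ q′ ] q ℚ.< q′ × Forced (λ w → q′ ∈ lower (real (O w)))

  Value : (World → 𝕀) → 𝕀
  Value O = record
    { real = record
      { lower     = λ q → Small (ForcedAbove O q)
      ; inhabited = let q , p<q , q<0 = dense (ℚₚ.negative⁻¹ (ℚ.- 1ℚ)) in
                    ℚ.- 1ℚ , fromWitness (q , p<q , 0 , λ w _ → 𝕀.0≤ (O w) q<0)
      ; bounded   = 1ℚ , λ 1∈ → ℚₚ.<-irrefl refl (<1 1∈)
      ; downward  = λ p<q q∈ → let q′ , q<q′ , ev = toWitness q∈ in
                    fromWitness (q′ , ℚₚ.<-trans p<q q<q′ , ev)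
      ; rounded   = λ p∈ →
          let q′ , p<q′ , ev = toWitness p∈ ; q , p<q , q<q′ = dense p<q′ in
          q , p<q , fromWitness (q′ , q<q′ , ev)
      }
    ; 0≤ = λ p<0 → let q , p<q , q<0 = dense p<0 in
           fromWitness (q , p<q , 0 , λ w _ → 𝕀.0≤ (O w) q<0)
    ; ≤1 = <1
    }
    where
    <1 : ∀ {p} → Small (ForcedAbove O p) → p ℚ.< 1ℚ
    <1 p∈ = let q , p<q , ev = toWitness p∈ ; w , q∈ = Forced-sat ev in
            ℚₚ.<-trans p<q (𝕀.≤1 (O w) q∈)

  Value-elim : ∀ O {q} → q ∈ lower (real (Value O)) → ForcedAbove O q
  Value-elim O = toWitness

  Value-intro : ∀ O {q q′} → q ℚ.< q′ → Forced (λ w → q′ ∈ lower (real (O w))) →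
                q ∈ lower (real (Value O))
  Value-intro O q<q′ ev = fromWitness (_ , q<q′ , ev)

  Value-∉ : ∀ O {q} → Forced (λ w → q ∉ lower (real (O w))) → q ∉ lower (real (Value O))
  Value-∉ O ev q∈ =
    let q′ , q<q′ , ev′ = Value-elim O q∈
        w , q∉ , q′∈ = Forced-sat (Forced-∩ ev ev′)
    in q∉ (downward (real (O w)) q<q′ q′∈)

  Value-mono : ∀ O O′ → (∀ w → real (O w) ≤ real (O′ w)) → real (Value O) ≤ real (Value O′)
  Value-mono O O′ O≤O′ p∈ =
    let q , p<q , ev = Value-elim O p∈
    in Value-intro O′ p<q (Forced-map (λ w → O≤O′ w) ev)

  Value-cong : ∀ O O′ → (∀ w → real (O w) ≃ real (O′ w)) → real (Value O) ≃ real (Value O′)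
  Value-cong O O′ O≃O′ = Value-mono O O′ (λ w → proj₁ (O≃O′ w)) ,
                         Value-mono O′ O (λ w → proj₂ (O≃O′ w))

  -- The point where genericity makes upper bounds forced: for q < r < q′ the chain decides between
  -- r < φ and φ ≤ q′, and the former would put q below the value.
  ∉Value⇒forced : ∀ {n} {φ : Formula S n} → φ ∈ L n → ∀ a {q q′} →
    q ∉ lower (real (Value (value-ω φ a))) → q ℚ.< q′ →
    Forced (λ w → q′ ∉ lower (real (value-ω φ a w)))
  ∉Value⇒forced {φ = φ} φ∈L a q∉ q<q′ =
    let r , q<r , r<q′ = dense q<q′ in
    [ (λ ev → contradiction (Value-intro (value-ω φ a) q<r ev) q∉) , (λ ev → ev) ]′
      (decide a φ∈L r<q′)

  -- The term model

  distance : ωTerm → ωTerm → World → 𝕀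
  distance t u w = Structure.dᵢ (model w) (⟦ t ⟧ w) (⟦ u ⟧ w)

  distance-forced : ∀ t u {q q′} → q ∉ lower (real (Value (distance t u))) → q ℚ.< q′ →
                    Forced (λ w → q′ ∉ lower (real (distance t u w)))
  distance-forced t u = ∉Value⇒forced (dist-∈ (var zero) (var (suc zero))) (t ∷ u ∷ [])

  private module Metric (w : World) = MetricProperties (Structure.metricSpace (model w))

  termSpace : MetricSpace
  termSpace = mkMetricSpace {ωTerm} (λ t u → Value (distance t u))
    (λ t {p} p∈ →
      let q , p<q , ev = Value-elim (distance t t) p∈ ; w , q∈ = Forced-sat ev
      in ℚₚ.<-trans p<q (Metric.d-refl w (⟦ t ⟧ w) q∈))
    (λ t u → Value-mono (distance t u) (distance u t)
               (λ w → Metric.d-sym-≤ w (⟦ t ⟧ w) (⟦ u ⟧ w)))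
    λ t u v {q} {r} q∉ r∉ q+r∈ →
      let s , q+r<s , ev = Value-elim (distance t v) q+r∈
          -- Upper bounds are forced only with a gap, so the excess of s over q + r is shared
          -- between both distances.
          a , b , a+b≡s , q<a , r<b = split q+r<s
          w , (a∉ , b∉) , s∈ = Forced-sat (Forced-∩
            (Forced-∩ (distance-forced t u q∉ q<a) (distance-forced u v r∉ r<b)) ev)
      in Metric.d-triangle w (⟦ t ⟧ w) (⟦ u ⟧ w) (⟦ v ⟧ w) a∉ b∉
           (subst (_∈ lower (real (distance t v w))) (sym a+b≡s) s∈)
    where
    split : ∀ {q r s} → q ℚ.+ r ℚ.< s →
            ∃[ a ] ∃[ b ] a ℚ.+ b ≡ s × q ℚ.< a × r ℚ.< b
    split {q} {r} {s} q+r<s =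
      let a , q<a , a<s-r = dense {q} {s ℚ.- r} (<-by q+r<s
            (solve 3 (λ q r s → q :+ s := s :- r :+ (q :+ r)) refl q r s))
      in a , s ℚ.- a , solve 2 (λ a s → a :+ (s :- a) := s) refl a s , q<a ,
         <-by a<s-r (solve 3 (λ a r s → r :+ (s :- r) := s :- a :+ a) refl a r s)

  private module 𝕋 = MetricSpace termSpace

  dⁿ-forced : ∀ {n} (a b : Vec ωTerm n) {q q′} → q ∉ lower (𝕋.dⁿ a b) → q ℚ.< q′ →
              Forced (λ w → q′ ∉ lower (Structure.dⁿ (model w) (⟦ a ⟧ₛ w) (⟦ b ⟧ₛ w)))
  dⁿ-forced []      []      q≮0 q<q′ = 0 , λ _ _ q′<0 → q≮0 (ℚₚ.<-trans q<q′ q′<0)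
  dⁿ-forced (t ∷ a) (u ∷ b) q∉  q<q′ = Forced-map (λ w (t∉ , ts∉) → [ t∉ , ts∉ ]′)
    (Forced-∩ (distance-forced t u (λ q∈ → q∉ (inj₁ q∈)) q<q′)
              (dⁿ-forced a b (λ q∈ → q∉ (inj₂ q∈)) q<q′))

  dⁿ<-forced : ∀ {n} (a b : Vec ωTerm n) {δ} → 𝕋.dⁿ a b < fromℚ δ →
               Forced (λ w → Structure.dⁿ (model w) (⟦ a ⟧ₛ w) (⟦ b ⟧ₛ w) < fromℚ δ)
  dⁿ<-forced a b (q , q<δ , q∉) =
    let r , q<r , r<δ = dense q<δ
    in Forced-map (λ w r∉ → r , r<δ , r∉) (dⁿ-forced a b q∉ q<r)

  relation : (P : Rel) → Vec ωTerm (arityR P) → World → 𝕀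
  relation P a w = Structure.rel (model w) P (⟦ a ⟧ₛ w)

  relation-forced : ∀ P a {q q′} → q ∉ lower (real (Value (relation P a))) → q ℚ.< q′ →
                    Forced (λ w → q′ ∉ lower (real (relation P a w)))
  relation-forced P a {q} {q′} q∉ q<q′ = Forced-map
    (λ w → subst (λ b → q′ ∉ lower (real (Structure.rel (model w) P b))) (vars-id w))
    (∉Value⇒forced (rel-∈ P (vars (λ i → i))) a
      (λ q∈ → q∉ (Value-mono (value-ω (rel P (vars (λ i → i))) a) (relation P a)
        (λ w {p} → subst (λ b → p ∈ lower (real (Structure.rel (model w) P b))) (vars-id w))
        q∈))
      q<q′)
    where
    vars-id : ∀ w → evalₜₛ (model w) (vars (λ i → i)) (⟦ a ⟧ₛ w) ≡ ⟦ a ⟧ₛ w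
    vars-id w = trans (evalₜₛ-vars (model w) (λ i → i) (⟦ a ⟧ₛ w))
                      (Vecₚ.tabulate∘lookup (⟦ a ⟧ₛ w))

  -- Transfers the modulus of a predicate symbol from worlds to values: if O > r were forced for
  -- some r > q + ε, a common world would also satisfy O′ ≤ r - ε, against the comparison there.
  Value-shift : ∀ O O′ {ε q} →
    (∀ {q q′} → q ∉ lower (real (Value O′)) → q ℚ.< q′ →
       Forced (λ w → q′ ∉ lower (real (O′ w)))) →
    Forced (λ w → ∀ q → q ℚ.+ ε ∈ lower (real (O w)) → q ∈ lower (real (O′ w))) →
    q ∉ lower (real (Value O′)) → q ℚ.+ ε ∉ lower (real (Value O))
  Value-shift O O′ {ε} {q} O′-forced shift q∉ q+ε∈ =
    let r , q+ε<r , ev = Value-elim O q+ε∈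
        w , (shift′ , r-ε∉) , r∈ = Forced-sat (Forced-∩ (Forced-∩ shift
          (O′-forced q∉ (<-by q+ε<r
            (solve 3 (λ q r ε → q :+ r := r :- ε :+ (q :+ ε)) refl q r ε)))) ev)
    in r-ε∉ (shift′ (r ℚ.- ε) (subst (_∈ lower (real (O w)))
         (solve 2 (λ r ε → r := r :- ε :+ ε) refl r ε) r∈))

  termModel : Structure S
  termModel = record
    { metricSpace = termSpace
    ; point = var 0
    ; fun = fun
    ; rel = λ P a → Value (relation P a)
    ; con = con
    ; fun-modulus = λ f ε a b d<δ {p} p∈ →
        let q , p<q , ev = Value-elim (distance (fun f a) (fun f b)) p∈
            w , d<δ′ , q∈ = Forced-sat (Forced-∩ (dⁿ<-forced a b d<δ) ev)
        in ℚₚ.<-trans p<q (Structure.fun-modulus (model w) f ε (⟦ a ⟧ₛ w) (⟦ b ⟧ₛ w) d<δ′ q∈)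
    ; rel-modulus = λ P ε a b d<δ → ∣-∣≤-intro
        (real (Value (relation P a))) (real (Value (relation P b)))
        (Value-shift (relation P a) (relation P b) (relation-forced P b) (Forced-map
          (λ w d<δ′ q → ∣-∣≤-elimˡ (real (relation P a w)) (real (relation P b w))
            (Structure.rel-modulus (model w) P ε (⟦ a ⟧ₛ w) (⟦ b ⟧ₛ w) d<δ′))
          (dⁿ<-forced a b d<δ)))
        (Value-shift (relation P b) (relation P a) (relation-forced P a) (Forced-map
          (λ w d<δ′ q → ∣-∣≤-elimʳ (real (relation P a w)) (real (relation P b w))
            (Structure.rel-modulus (model w) P ε (⟦ a ⟧ₛ w) (⟦ b ⟧ₛ w) d<δ′))
          (dⁿ<-forced a b d<δ)))
    }

  mutual
    ⟦evalₜ⟧ : ∀ {n} (t : Term S n) (a : Vec ωTerm n) w →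
              ⟦ evalₜ termModel t a ⟧ w ≡ evalₜ (model w) t (⟦ a ⟧ₛ w)
    ⟦evalₜ⟧ (var x)    a w = ⟦lookup⟧ a x w
    ⟦evalₜ⟧ (con c)    a w = refl
    ⟦evalₜ⟧ (fun f ts) a w = cong (Structure.fun (model w) f) (⟦evalₜₛ⟧ ts a w)

    ⟦evalₜₛ⟧ : ∀ {n m} (ts : Vec (Term S n) m) (a : Vec ωTerm n) w →
               ⟦ evalₜₛ termModel ts a ⟧ₛ w ≡ evalₜₛ (model w) ts (⟦ a ⟧ₛ w)
    ⟦evalₜₛ⟧ []       a w = refl
    ⟦evalₜₛ⟧ (t ∷ ts) a w = cong₂ _∷_ (⟦evalₜ⟧ t a w) (⟦evalₜₛ⟧ ts a w)

    ⟦lookup⟧ : ∀ {n} (a : Vec ωTerm n) x w → ⟦ lookup a x ⟧ w ≡ lookup (⟦ a ⟧ₛ w) x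
    ⟦lookup⟧ (t ∷ a) zero    w = refl
    ⟦lookup⟧ (t ∷ a) (suc x) w = ⟦lookup⟧ a x w

  -- The forcing theorem, by induction along subformulas, which stay in `L`. For implications and
  -- suprema, passing from forced values to values in the model uses the witnesses met along the
  -- chain.
  truth : ∀ {n} (φ : Formula S n) → φ ∈ L n → ∀ a →
          real (eval termModel φ a) ≃ real (Value (value-ω φ a))
  truth (dist s t) _ a = Value-cong
    (distance (evalₜ termModel s a) (evalₜ termModel t a)) (value-ω (dist s t) a)
    λ w → subst₂ (λ x y → real (distance (evalₜ termModel s a) (evalₜ termModel t a) w)
                            ≃ Structure.d (model w) x y)
            (⟦evalₜ⟧ s a w) (⟦evalₜ⟧ t a w)
            (≃-refl (real (distance (evalₜ termModel s a) (evalₜ termModel t a) w)))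
  truth (rel P ts) _ a = Value-cong
    (relation P (evalₜₛ termModel ts a)) (value-ω (rel P ts) a)
    λ w → subst (λ b → real (relation P (evalₜₛ termModel ts a) w)
                         ≃ real (Structure.rel (model w) P b))
            (⟦evalₜₛ⟧ ts a w) (≃-refl (real (relation P (evalₜₛ termModel ts a) w)))
  truth (const q) _ a =
    (λ p<q → let r , p<r , r<q = dense p<q in
             Value-intro (value-ω (const q) a) p<r (0 , λ _ _ → r<q)) ,
    λ p∈ → let r , p<r , ev = Value-elim (value-ω (const q) a) p∈
               w , r<q = Forced-sat ev
           in ℚₚ.<-trans p<r r<q
  truth (φ ⇒ ψ) ∈L a = to , from
    where
    x = eval termModel φ a ; x′ = Value (value-ω φ a)
    y = eval termModel ψ a ; y′ = Value (value-ω ψ a)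
    φ∈L = ⇒-subˡ ∈L ; ψ∈L = ⇒-subʳ ∈L
    to : ∀ {p} → p ∈ lower (real (x ⇒ᵢ y)) → p ∈ lower (real (Value (value-ω (φ ⇒ ψ) a)))
    to {p} p∈ =
      let s , t , s∈ , t∉ , p<1-t+s = ⇒-elim x y p∈
          s′ , s<s′ , s′-ev = Value-elim (value-ω ψ a) (proj₁ (truth ψ ψ∈L a) s∈)
          p₁ , p<p₁ , p₁<1-t+s′ = dense (ℚₚ.<-trans p<1-t+s (ℚₚ.+-monoʳ-< (1ℚ ℚ.- t) s<s′))
          q , p<q , q<1 = dense (⇒-≤1 x y p∈)
          -- `Value-intro` needs a forced bound above p; r raises p while staying below both 1 and 1
          -- - t + s′.
          r , p<r , r≤q , r≤p₁ = meet-above p<q p<p₁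
          t′ , t<t′ , t′<1+s′-r = dense {t} {1ℚ ℚ.+ s′ ℚ.- r} (<-by
            (ℚₚ.≤-<-trans r≤p₁ p₁<1-t+s′) (solve 3 (λ r s t →
               t :+ (:con 1ℚ :- t :+ s) := :con 1ℚ :+ s :- r :+ r) refl r s′ t))
          t′-ev = ∉Value⇒forced φ∈L a (λ t∈ → t∉ (proj₂ (truth φ φ∈L a) t∈)) t<t′
      in Value-intro (value-ω (φ ⇒ ψ) a) p<r
           (Forced-map (λ w (s′∈ , t′∉) → ⇒-intro (value-ω φ a w) (value-ω ψ a w)
              (ℚₚ.≤-<-trans r≤q q<1) s′∈ t′∉
              (<-by t′<1+s′-r (solve 3 (λ r s t →
                 r :+ (:con 1ℚ :+ s :- r) := :con 1ℚ :- t :+ s :+ t) refl r s′ t′)))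
             (Forced-∩ s′-ev t′-ev))
      where
      meet-above : ∀ {p a b} → p ℚ.< a → p ℚ.< b → ∃[ c ] p ℚ.< c × c ℚ.≤ a × c ℚ.≤ b
      meet-above {p} {a} {b} p<a p<b with ℚₚ.≤-total a b
      ... | inj₁ a≤b = a , p<a , ℚₚ.≤-refl , a≤b
      ... | inj₂ b≤a = b , p<b , b≤a , ℚₚ.≤-refl
    from : ∀ {p} → p ∈ lower (real (Value (value-ω (φ ⇒ ψ) a))) → p ∈ lower (real (x ⇒ᵢ y))
    from {p} p∈ =
      let q , p<q , ev = Value-elim (value-ω (φ ⇒ ψ) a) p∈
          s , t , q<1-t+s , s-ev , t-ev = witness-⇒ a ∈L ev
          -- A forced bound s gives only smaller elements s′ of the value; the loss is kept below q
          -- - p.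
          s′ , s-[q-p]<s′ , s′<s = dense {s ℚ.- (q ℚ.- p)} {s}
            (<-by p<q (solve 3 (λ s p q → s :- (q :- p) :+ q := s :+ p) refl s p q))
      in ⇒-intro x y (𝕀.≤1 (Value (value-ω (φ ⇒ ψ) a)) p∈)
           (proj₂ (truth ψ ψ∈L a) (Value-intro (value-ω ψ a) s′<s s-ev))
           (λ t∈ → Value-∉ (value-ω φ a) t-ev (proj₁ (truth φ φ∈L a) t∈))
           (<-by (ℚₚ.+-mono-< q<1-t+s s-[q-p]<s′) (solve 5 (λ p q s s′ t →
              p :+ (:con 1ℚ :- t :+ s :+ s′) := :con 1ℚ :- t :+ s′ :+ (q :+ (s :- (q :- p))))
              refl p q s s′ t))
  truth (sup φ) ∈L a =
    (λ (u , p∈) →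
      let q , p<q , ev = Value-elim (value-ω φ (u ∷ a)) (proj₁ (truth φ (sup-sub ∈L) (u ∷ a)) p∈)
      in Value-intro (value-ω (sup φ) a) p<q (Forced-map (λ w q∈ → ⟦ u ⟧ w , q∈) ev)) ,
    λ p∈ →
      let q , p<q , ev = Value-elim (value-ω (sup φ) a) p∈
          u , ev′ = witness-sup a ∈L ev
      in u , proj₂ (truth φ (sup-sub ∈L) (u ∷ a)) (Value-intro (value-ω φ (u ∷ a)) p<q ev′)
  truth (supω φ) ∈L a =
    (λ (i , p∈) →
      let q , p<q , ev = Value-elim (value-ω (φ i) a) (proj₁ (truth (φ i) (supω-sub ∈L i) a) p∈)
      in Value-intro (value-ω (supω φ) a) p<q (Forced-map (λ w q∈ → i , q∈) ev)) ,
    λ p∈ →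
      let q , p<q , ev = Value-elim (value-ω (supω φ) a) p∈
          i , ev′ = witness-supω a ∈L ev
      in i , proj₂ (truth (φ i) (supω-sub ∈L i) a) (Value-intro (value-ω (φ i) a) p<q ev′)

  termModel-models : IsTheory L T → termModel ⊨* T
  termModel-models T⊆L {σ} σ∈T = ≃1 (eval termModel σ []) λ p<1 →
    let q , p<q , q<1 = dense p<1
    in proj₂ (truth σ (T⊆L σ∈T) []) (Value-intro (value-ω σ []) p<q
         (0 , λ w _ → proj₂ (models w σ∈T) q<1))

  termModel-omits : ∀ n → Omits termModel (Ψ n)
  termModel-omits n a realizes =
    let σ , σ∈Ψ , q , q<1 , ev = forced-omit n a
    in Value-∉ (value-ω σ a) ev
         (proj₁ (truth σ (Ψ⊆L n σ∈Ψ) a) (proj₂ (realizes σ∈Ψ) q<1))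

-- The completion

_⊓ᵥ_ : (α β : ℚ⟨0,1⟩) → Σ[ γ ∈ ℚ⟨0,1⟩ ] val γ ℚ.≤ val α × val γ ℚ.≤ val β
α ⊓ᵥ β with ℚₚ.≤-total (val α) (val β)
... | inj₁ α≤β = α , ℚₚ.≤-refl , α≤β
... | inj₂ β≤α = β , β≤α , ℚₚ.≤-refl

½ᵥ : ℚ⟨0,1⟩
½ᵥ = ⟨ ½ , ℚₚ.positive⁻¹ ½ , from-yes (½ ℚₚ.<? 1ℚ) ⟩

0<val : ∀ ε → 0ℚ ℚ.< val ε
0<val = ℚ⟨0,1⟩.0<

half : ℚ⟨0,1⟩ → ℚ⟨0,1⟩
half ε = proj₁ (halve (0<val ε))

half+half< : ∀ ε → val (half ε) ℚ.+ val (half ε) ℚ.< val ε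
half+half< ε = proj₂ (halve (0<val ε))

-- The completion by regular functions: X stands for the limit of X ε as ε → 0,
-- where X ε is within ε of the limit.
module Completion (em : ∀ ℓ → ExcludedMiddle ℓ) {S : Signature} (M : Structure S) where

  open Signature S
  open Classical em
  open Structure M renaming (fun to funᴹ; rel to relᴹ; con to conᴹ)
  open MetricProperties metricSpace

  record Regular : Set where
    field
      at      : ℚ⟨0,1⟩ → Carrier
      regular : ∀ ε δ → val ε ℚ.+ val δ ∉ lower (d (at ε) (at δ))

  open Regular

  ats : ∀ {n} → Vec Regular n → ℚ⟨0,1⟩ → Vec Carrier n
  ats Xs ε = Vec.map (λ X → at X ε) Xs

  ι : Carrier → Regular
  ι x = record
    { at = λ _ → x
    ; regular = λ ε δ → d-refl-∉ x (ℚₚ.<⇒≤ (ℚₚ.+-mono-< (0<val ε) (0<val δ)))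
    }

  -- The supremum of d (X ε) (Y δ) - ε - δ.
  d̄ : Regular → Regular → 𝕀
  d̄ X Y = record
    { real = record
      { lower     = λ q → ∃[ ε ] ∃[ δ ] q ℚ.+ (val ε ℚ.+ val δ) ∈ lower (d (at X ε) (at Y δ))
      ; inhabited = let ε = ½ᵥ ; p , p∈ = inhabited (d (at X ε) (at Y ε)) in
          p ℚ.- (val ε ℚ.+ val ε) , ε , ε , subst (_∈ lower (d (at X ε) (at Y ε)))
            (solve 2 (λ p e → p := p :- e :+ e) refl p (val ε ℚ.+ val ε)) p∈
      ; bounded   = 1ℚ , λ (ε , δ , 1+ε+δ∈) →
          ℚₚ.<-asym (d≤1 _ _ 1+ε+δ∈) (q<q+ε (ℚₚ.+-mono-< (0<val ε) (0<val δ)))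
      ; downward  = λ p<q (ε , δ , q∈) → ε , δ ,
          downward (d (at X ε) (at Y δ)) (ℚₚ.+-monoˡ-< (val ε ℚ.+ val δ) p<q) q∈
      ; rounded   = λ {p} (ε , δ , p∈) →
          let q , p<q , q∈ = rounded (d (at X ε) (at Y δ)) p∈ ; e = val ε ℚ.+ val δ in
          q ℚ.- e ,
          <-by p<q (solve 3 (λ p q e → p :+ q := q :- e :+ (p :+ e)) refl p q e) ,
          ε , δ , subst (_∈ lower (d (at X ε) (at Y δ)))
            (solve 2 (λ q e → q := q :- e :+ e) refl q e) q∈
      }
    ; 0≤ = λ {p} p<0 →
        let ε , ε+ε<-p = halve (ℚₚ.neg-antimono-< p<0) in
        ε , ε , nonNegative (<-by ε+ε<-p
          (solve 2 (λ p e → p :+ e :+ :- p := :con 0ℚ :+ e) refl p (val ε ℚ.+ val ε)))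
    ; ≤1 = λ (ε , δ , p∈) → ℚₚ.<-trans (q<q+ε (ℚₚ.+-mono-< (0<val ε) (0<val δ))) (d≤1 _ _ p∈)
    }

  -- The route passes through `Y η`, where the extra 2η fits into the room that roundedness leaves.
  d̄-triangle : ∀ X Y Z {q r} → q ∉ lower (real (d̄ X Y)) → r ∉ lower (real (d̄ Y Z)) →
               q ℚ.+ r ∉ lower (real (d̄ X Z))
  d̄-triangle X Y Z {q} {r} q∉ r∉ (ε , δ , p∈) =
    let w , p<w , w∈ = rounded (d (at X ε) (at Z δ)) p∈
        η , η+η<w-p = halve (0<q-p p<w)
    in d-triangle (at X ε) (at Y η) (at Z δ)
         (λ q∈ → q∉ (ε , η , q∈)) (λ r∈ → r∉ (η , δ , r∈))
         (downward (d (at X ε) (at Z δ))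
           (<-by η+η<w-p (solve 6 (λ q r ε δ η w →
              q :+ (ε :+ η) :+ (r :+ (η :+ δ)) :+ (w :- (q :+ r :+ (ε :+ δ)))
                := w :+ (η :+ η)) refl q r (val ε) (val δ) (val η) w))
           w∈)

  completionSpace : MetricSpace
  completionSpace = mkMetricSpace d̄
    (λ X {p} (ε , δ , p∈) → <-by (∈-∉⇒< (d (at X ε) (at X δ)) p∈ (regular X ε δ))
      (solve 2 (λ p e → p :+ e := :con 0ℚ :+ (p :+ e)) refl p (val ε ℚ.+ val δ)))
    (λ X Y {p} (ε , δ , p∈) → δ , ε , subst (_∈ lower (d (at Y δ) (at X ε)))
      (cong (p ℚ.+_) (ℚₚ.+-comm (val ε) (val δ))) (d-sym-≤ (at X ε) (at Y δ) p∈))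
    d̄-triangle

  private module 𝕏 = MetricSpace completionSpace

  dⁿ-ats : ∀ {n} (Xs Ys : Vec Regular n) {q} → q ∉ lower (𝕏.dⁿ Xs Ys) → ∀ γ →
           q ℚ.+ (val γ ℚ.+ val γ) ∉ lower (dⁿ (ats Xs γ) (ats Ys γ))
  dⁿ-ats []       []       {q} q≮0 γ q+2γ<0 =
    q≮0 (ℚₚ.<-trans (q<q+ε (ℚₚ.+-mono-< (0<val γ) (0<val γ))) q+2γ<0)
  dⁿ-ats (X ∷ Xs) (Y ∷ Ys) q∉  γ =
    [ (λ q∈ → q∉ (inj₁ (γ , γ , q∈))) , dⁿ-ats Xs Ys (λ q∈ → q∉ (inj₂ q∈)) γ ]′

  dⁿ-regular : ∀ {n} (Xs : Vec Regular n) ε δ →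
               val ε ℚ.+ val δ ∉ lower (dⁿ (ats Xs ε) (ats Xs δ))
  dⁿ-regular []       ε δ = ℚₚ.<-asym (ℚₚ.+-mono-< (0<val ε) (0<val δ))
  dⁿ-regular (X ∷ Xs) ε δ = [ regular X ε δ , dⁿ-regular Xs ε δ ]′

  dⁿ-ats-half : ∀ {n} (Xs : Vec Regular n) ε γ → val γ ℚ.≤ val (half ε) →
                dⁿ (ats Xs γ) (ats Xs (half ε)) < fromℚ⟨0,1⟩ ε
  dⁿ-ats-half Xs ε γ γ≤half =
    val γ ℚ.+ val (half ε) ,
    ℚₚ.≤-<-trans (ℚₚ.+-monoˡ-≤ (val (half ε)) γ≤half) (half+half< ε) ,
    dⁿ-regular Xs γ (half ε)

  dⁿ-ats-< : ∀ {n} (Xs Ys : Vec Regular n) {δ} → 𝕏.dⁿ Xs Ys < fromℚ δ →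
             Σ[ γ₀ ∈ ℚ⟨0,1⟩ ] ∀ γ → val γ ℚ.≤ val γ₀ →
               dⁿ (ats Xs γ) (ats Ys γ) < fromℚ δ
  dⁿ-ats-< Xs Ys {δ} (q , q<δ , q∉) =
    let γ₀ , 2γ₀<δ-q = halve (0<q-p q<δ)
    in γ₀ , λ γ γ≤γ₀ → q ℚ.+ (val γ ℚ.+ val γ) ,
         <-by (ℚₚ.≤-<-trans (ℚₚ.+-mono-≤ γ≤γ₀ γ≤γ₀) 2γ₀<δ-q)
           (solve 3 (λ q δ e → q :+ e :+ (δ :- q) := δ :+ e) refl q δ (val γ ℚ.+ val γ)) ,
         dⁿ-ats Xs Ys q∉ γ

  module _ (f : Fun) where

    -- Half the modulus, so that X η and X η′ are within the modulus if η′ ≤ η.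
    ηF : ℚ⟨0,1⟩ → ℚ⟨0,1⟩
    ηF ε = half (modulusF f ε)

    fun-near : ∀ Xs ε γ → val γ ℚ.≤ val (ηF ε) →
               val ε ∉ lower (d (funᴹ f (ats Xs γ)) (funᴹ f (ats Xs (ηF ε))))
    fun-near Xs ε γ γ≤η = ∉-of-≤ (d (funᴹ f (ats Xs γ)) (funᴹ f (ats Xs (ηF ε))))
      (fun-modulus f ε (ats Xs γ) (ats Xs (ηF ε)) (dⁿ-ats-half Xs (modulusF f ε) γ γ≤η))

    fun-near′ : ∀ Xs ε γ → val γ ℚ.≤ val (ηF ε) →
                val ε ∉ lower (d (funᴹ f (ats Xs (ηF ε))) (funᴹ f (ats Xs γ)))
    fun-near′ Xs ε γ γ≤η ε∈ = fun-near Xs ε γ γ≤η (d-sym-≤ _ _ ε∈)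

    fun̄ : Vec Regular (arityF f) → Regular
    fun̄ Xs = record
      { at = λ ε → funᴹ f (ats Xs (ηF ε))
      ; regular = reg
      }
      where
      reg : ∀ ε δ → val ε ℚ.+ val δ ∉ lower (d (funᴹ f (ats Xs (ηF ε))) (funᴹ f (ats Xs (ηF δ))))
      reg ε δ with ℚₚ.≤-total (val (ηF ε)) (val (ηF δ))
      ... | inj₁ ≤η = ∉-upward (d (funᴹ f (ats Xs (ηF ε))) (funᴹ f (ats Xs (ηF δ))))
        (≤-by (ℚₚ.<⇒≤ (0<val ε)) (solve 2 (λ ε δ → δ :+ ε := ε :+ δ :+ :con 0ℚ) refl (val ε) (val δ)))
        (fun-near Xs δ (ηF ε) ≤η)
      ... | inj₂ ≥η = ∉-upward (d (funᴹ f (ats Xs (ηF ε))) (funᴹ f (ats Xs (ηF δ))))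
        (≤-by (ℚₚ.<⇒≤ (0<val δ)) (solve 2 (λ ε δ → ε :+ δ := ε :+ δ :+ :con 0ℚ) refl (val ε) (val δ)))
        (fun-near′ Xs ε (ηF δ) ≥η)

    -- Both sides are compared at a common level γ below γ₀, `ηF α` and `ηF β`. Reaching it costs α
    -- and β, exactly what `d̄` subtracts.
    fun̄-modulus : ∀ ε Xs Ys → 𝕏.dⁿ Xs Ys < fromℚ⟨0,1⟩ (modulusF f ε) →
                  𝕏.d (fun̄ Xs) (fun̄ Ys) ≤ fromℚ⟨0,1⟩ ε
    fun̄-modulus ε Xs Ys d<δ {p} (α , β , p∈) =
      let γ₀ , close = dⁿ-ats-< Xs Ys d<δ
          γ₁ , γ₁≤γ₀ , γ₁≤ηα = γ₀ ⊓ᵥ ηF α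
          γ , γ≤γ₁ , γ≤ηβ = γ₁ ⊓ᵥ ηF β
          x = funᴹ f (ats Xs (ηF α)) ; y = funᴹ f (ats Ys (ηF β))
          x′ = funᴹ f (ats Xs γ) ; y′ = funᴹ f (ats Ys γ)
          x′-y′ = ∉-of-≤ (d x′ y′) (fun-modulus f ε (ats Xs γ) (ats Ys γ)
                    (close γ (ℚₚ.≤-trans γ≤γ₁ γ₁≤γ₀)))
          x-y = d-triangle x y′ y
                  (d-triangle x x′ y′ (fun-near′ Xs α γ (ℚₚ.≤-trans γ≤γ₁ γ₁≤ηα)) x′-y′)
                  (fun-near Ys β γ γ≤ηβ)
      in <-by (∈-∉⇒< (d x y) p∈ x-y) (solve 4 (λ p ε α β →
           p :+ (α :+ ε :+ β) := ε :+ (p :+ (α :+ β))) refl p (val ε) (val α) (val β))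

  module _ (P : Rel) where

    ηR : ℚ⟨0,1⟩ → ℚ⟨0,1⟩
    ηR ε = half (modulusR P ε)

    relᵣ : Vec Carrier (arityR P) → ℝ
    relᵣ a = real (relᴹ P a)

    rel-near : ∀ Xs ε γ → val γ ℚ.≤ val (ηR ε) →
               ∣ relᵣ (ats Xs γ) - relᵣ (ats Xs (ηR ε)) ∣ ≤ fromℚ⟨0,1⟩ ε
    rel-near Xs ε γ γ≤η = rel-modulus P ε (ats Xs γ) (ats Xs (ηR ε))
      (dⁿ-ats-half Xs (modulusR P ε) γ γ≤η)

    -- The supremum of P (X (ηR ε)) - ε.
    rel̄ : Vec Regular (arityR P) → 𝕀
    rel̄ Xs = record
      { real = record
        { lower     = λ q → ∃[ ε ] q ℚ.+ val ε ∈ lower (relᵣ (ats Xs (ηR ε)))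
        ; inhabited = let ε = ½ᵥ ; p , p∈ = inhabited (relᵣ (ats Xs (ηR ε))) in
            p ℚ.- val ε , ε , subst (_∈ lower (relᵣ (ats Xs (ηR ε))))
              (solve 2 (λ p e → p := p :- e :+ e) refl p (val ε)) p∈
        ; bounded   = 1ℚ , λ (ε , 1+ε∈) →
            ℚₚ.<-asym (𝕀.≤1 (relᴹ P (ats Xs (ηR ε))) 1+ε∈) (q<q+ε (0<val ε))
        ; downward  = λ p<q (ε , q∈) → ε ,
            downward (relᵣ (ats Xs (ηR ε))) (ℚₚ.+-monoˡ-< (val ε) p<q) q∈
        ; rounded   = λ {p} (ε , p∈) →
            let q , p<q , q∈ = rounded (relᵣ (ats Xs (ηR ε))) p∈ ; e = val ε in
            q ℚ.- e ,
            <-by p<q (solve 3 (λ p q e → p :+ q := q :- e :+ (p :+ e)) refl p q e) ,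
            ε , subst (_∈ lower (relᵣ (ats Xs (ηR ε))))
              (solve 2 (λ q e → q := q :- e :+ e) refl q e) q∈
        }
      ; 0≤ = λ {p} p<0 →
          let ε , ε+ε<-p = halve (ℚₚ.neg-antimono-< p<0) in
          ε , 𝕀.0≤ (relᴹ P (ats Xs (ηR ε)))
            (<-by (ℚₚ.<-trans (q<q+ε {val ε} (0<val ε)) ε+ε<-p)
              (solve 2 (λ p e → p :+ e :+ :- p := :con 0ℚ :+ e) refl p (val ε)))
      ; ≤1 = λ (ε , p∈) → ℚₚ.<-trans (q<q+ε (0<val ε)) (𝕀.≤1 (relᴹ P (ats Xs (ηR ε))) p∈)
      }

    -- The same passage through a common level γ, for predicates. The level β is chosen with 2β < w
    -- - p: one β is lost on the way and one is subtracted in `rel̄`.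
    rel̄-shift : ∀ {e} Xs Ys γ₀ →
      (∀ γ → val γ ℚ.≤ val γ₀ → ∀ q → q ℚ.+ e ∈ lower (relᵣ (ats Xs γ)) →
         q ∈ lower (relᵣ (ats Ys γ))) →
      ∀ {q} → q ∉ lower (real (rel̄ Ys)) → q ℚ.+ e ∉ lower (real (rel̄ Xs))
    rel̄-shift {e} Xs Ys γ₀ shift {q} q∉ (α , p∈) =
      let w , p<w , w∈ = rounded (relᵣ (ats Xs (ηR α))) p∈
          β , 2β<w-p = halve (0<q-p p<w)
          γ₁ , γ₁≤γ₀ , γ₁≤ηα = γ₀ ⊓ᵥ ηR α
          γ , γ≤γ₁ , γ≤ηβ = γ₁ ⊓ᵥ ηR β
          a = val α ; b = val β
          w-α∈ = ∣-∣≤-elimʳ (relᵣ (ats Xs γ)) (relᵣ (ats Xs (ηR α))) {a} {w ℚ.- a}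
            (rel-near Xs α γ (ℚₚ.≤-trans γ≤γ₁ γ₁≤ηα))
            (subst (_∈ lower (relᵣ (ats Xs (ηR α))))
              (solve 2 (λ w a → w := w :- a :+ a) refl w a) w∈)
          w-α-e∈ = shift γ (ℚₚ.≤-trans γ≤γ₁ γ₁≤γ₀) (w ℚ.- a ℚ.- e)
            (subst (_∈ lower (relᵣ (ats Xs γ)))
              (solve 2 (λ w e → w := w :- e :+ e) refl (w ℚ.- a) e) w-α∈)
          w-α-e-β∈ = ∣-∣≤-elimˡ (relᵣ (ats Ys γ)) (relᵣ (ats Ys (ηR β)))
            {b} {w ℚ.- a ℚ.- e ℚ.- b} (rel-near Ys β γ γ≤ηβ)
            (subst (_∈ lower (relᵣ (ats Ys γ)))
              (solve 2 (λ w b → w := w :- b :+ b) refl (w ℚ.- a ℚ.- e) b) w-α-e∈)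
      in q∉ (β , downward (relᵣ (ats Ys (ηR β)))
           (<-by 2β<w-p (solve 5 (λ q e a b w →
              q :+ b :+ (w :- (q :+ e :+ a)) := w :- a :- e :- b :+ (b :+ b))
              refl q e a b w))
           w-α-e-β∈)

    rel̄-modulus : ∀ ε Xs Ys → 𝕏.dⁿ Xs Ys < fromℚ⟨0,1⟩ (modulusR P ε) →
                  ∣ real (rel̄ Xs) - real (rel̄ Ys) ∣ ≤ fromℚ⟨0,1⟩ ε
    rel̄-modulus ε Xs Ys d<δ =
      let γ₀ , close = dⁿ-ats-< Xs Ys d<δ
      in ∣-∣≤-intro (real (rel̄ Xs)) (real (rel̄ Ys))
           (λ {q} → rel̄-shift Xs Ys γ₀ (λ γ γ≤γ₀ r →
             ∣-∣≤-elimˡ (relᵣ (ats Xs γ)) (relᵣ (ats Ys γ))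
               (rel-modulus P ε (ats Xs γ) (ats Ys γ) (close γ γ≤γ₀))) {q})
           (λ {q} → rel̄-shift Ys Xs γ₀ (λ γ γ≤γ₀ r →
             ∣-∣≤-elimʳ (relᵣ (ats Xs γ)) (relᵣ (ats Ys γ))
               (rel-modulus P ε (ats Xs γ) (ats Ys γ) (close γ γ≤γ₀))) {q})

  completion : Structure S
  completion = record
    { metricSpace = completionSpace
    ; point = ι point
    ; fun = fun̄
    ; rel = rel̄
    ; con = λ c → ι (conᴹ c)
    ; fun-modulus = fun̄-modulus
    ; rel-modulus = rel̄-modulus
    }

  private module X̄ = MetricProperties completionSpace

  d̄-at : ∀ X ε → val ε ∉ lower (real (d̄ X (ι (at X ε))))
  d̄-at X ε (α , β , p∈) = regular X α ε (downward (d (at X α) (at X ε))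
    (<-by (0<val β) (solve 3 (λ α β ε → α :+ ε :+ β := ε :+ (α :+ β) :+ :con 0ℚ)
      refl (val α) (val β) (val ε))) p∈)

  d̄-at′ : ∀ X ε → val ε ∉ lower (real (d̄ (ι (at X ε)) X))
  d̄-at′ X ε p∈ = d̄-at X ε (X̄.d-sym-≤ (ι (at X ε)) X {val ε} p∈)

  d̄-ι : ∀ x y → d x y ≤ real (d̄ (ι x) (ι y))
  d̄-ι x y {p} p∈ =
    let q , p<q , q∈ = rounded (d x y) p∈
        ε , 2ε<q-p = halve (0<q-p p<q)
    in ε , ε , downward (d x y)
         (<-by 2ε<q-p (solve 3 (λ p q e → p :+ e :+ (q :- p) := q :+ e)
           refl p q (val ε ℚ.+ val ε))) q∈

  -- The limit is a diagonal: at ε it approximates, within `half ε`, the member from which on the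
  -- sequence varies by less than `half ε`. Any two such points are compared through a later member
  -- m.
  complete : 𝕏.Complete
  complete X cauchy = Y , λ ε 0<ε →
    let q , q∈ε , q≮0 = 0<ε
        r , q<r , r∈ε = rounded ε q∈ε
        -- From `X n` to Y the route costs a to reach `X (N a)`, a to reach its approximation `Y β`,
        -- and β from there to Y; and 2a < β.
        β , 2β<r = halve (ℚₚ.≤-<-trans (ℚₚ.≮⇒≥ q≮0) q<r)
        a = half β
    in N a , λ n N≤n → val a ℚ.+ val a ℚ.+ val β ,
         downward ε (ℚₚ.<-trans (ℚₚ.+-monoˡ-< (val β) (half+half< β)) 2β<r) r∈ε ,
         d̄-triangle (X n) (ι (at Y β)) Y {val a ℚ.+ val a} {val β}
           (d̄-triangle (X n) (X (N a)) (ι (at Y β)) {val a} {val a} (close a n (N a) N≤n ℕₚ.≤-refl)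
             (d̄-at (X (N a)) a))
           (d̄-at′ Y β)
    where
    modulus : ∀ ε → ∃[ N ] ∀ m n → N ℕ.≤ m → N ℕ.≤ n → 𝕏.d (X m) (X n) < fromℚ⟨0,1⟩ ε
    modulus ε = cauchy (fromℚ⟨0,1⟩ ε) (0ℚ , 0<val ε , ℚₚ.<-irrefl refl)
    N : ℚ⟨0,1⟩ → ℕ
    N ε = proj₁ (modulus ε)
    close : ∀ ε m n → N ε ℕ.≤ m → N ε ℕ.≤ n → val ε ∉ lower (real (d̄ (X m) (X n)))
    close ε m n N≤m N≤n = ∉-of-< (real (d̄ (X m) (X n))) (proj₂ (modulus ε) m n N≤m N≤n)
    Y : Regular
    Y = record
      { at = λ ε → at (X (N (half ε))) (half ε)
      ; regular = λ ε δ p∈ →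
          let a = half ε ; b = half δ
              Xa = X (N a) ; Xb = X (N b) ; m = N a ℕ.⊔ N b
              x = at Xa a ; y = at Xb b
          in d̄-triangle (ι x) (X m) (ι y) {val a ℚ.+ val a} {val b ℚ.+ val b}
               (d̄-triangle (ι x) Xa (X m) {val a} {val a} (d̄-at′ Xa a)
                 (close a (N a) m ℕₚ.≤-refl (ℕₚ.m≤m⊔n (N a) (N b))))
               (d̄-triangle (X m) Xb (ι y) {val b} {val b}
                 (close b m (N b) (ℕₚ.m≤n⊔m (N a) (N b)) ℕₚ.≤-refl) (d̄-at Xb b))
               (downward (real (d̄ (ι x) (ι y)))
                 (ℚₚ.+-mono-< (half+half< ε) (half+half< δ)) (d̄-ι x y p∈))
      }

-- Formulas in the completion

module CompletionEval (em : ∀ ℓ → ExcludedMiddle ℓ) {S : Signature} (M : Structure S)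
  (L : (n : ℕ) → Pred (Formula S n) 0ℓ) (L-fragment : IsFragment L)
  (L-continuous : IsContinuous L) where

  open Classical em
  open Completion em M
  open IsFragment L-fragment
  open Structure M using (Carrier)
  open Regular
  private
    module M̄ = Structure completion
    module X̄ = MetricProperties completionSpace

  ιs : ∀ {n} → Vec Carrier n → Vec Regular n
  ιs = Vec.map ι

  mutual
    -- A propositional equality at every level, because embedded points are constant functions.
    evalₜ-ι : ∀ {n} (t : Term S n) a ε → at (evalₜ completion t (ιs a)) ε ≡ evalₜ M t a
    evalₜ-ι (var x)    a ε = cong (λ X → at X ε) (Vecₚ.lookup-map x ι a)
    evalₜ-ι (con c)    a ε = refl
    evalₜ-ι (fun f ts) a ε = cong (Structure.fun M f) (evalₜₛ-ι ts a (ηF f ε))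

    evalₜₛ-ι : ∀ {n m} (ts : Vec (Term S n) m) a ε →
               ats (evalₜₛ completion ts (ιs a)) ε ≡ evalₜₛ M ts a
    evalₜₛ-ι []       a ε = refl
    evalₜₛ-ι (t ∷ ts) a ε = cong₂ _∷_ (evalₜ-ι t a ε) (evalₜₛ-ι ts a ε)

  -- Only `sup` sees the new points. A new point X is replaced by an approximation, and continuity
  -- of the subformula, in the completion and at X, keeps the loss within the room between p and q.
  eval-ι : ∀ {n} (φ : Formula S n) → φ ∈ L n → ∀ a →
           real (eval completion φ (ιs a)) ≃ real (eval M φ a)
  eval-ι (dist s t) _ a =
    (λ {p} (ε , δ , p∈) → downward (Structure.d M (evalₜ M s a) (evalₜ M t a))
      (q<q+ε (ℚₚ.+-mono-< (0<val ε) (0<val δ)))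
      (subst₂ (λ x y → p ℚ.+ (val ε ℚ.+ val δ) ∈ lower (Structure.d M x y))
        (evalₜ-ι s a ε) (evalₜ-ι t a δ) p∈)) ,
    λ {p} p∈ →
      let ε , δ , p∈′ = d̄-ι (evalₜ M s a) (evalₜ M t a) p∈
      in ε , δ , subst₂ (λ x y → p ℚ.+ (val ε ℚ.+ val δ) ∈ lower (Structure.d M x y))
           (sym (evalₜ-ι s a ε)) (sym (evalₜ-ι t a δ)) p∈′
  eval-ι (rel P ts) _ a =
    (λ {p} (ε , p∈) → downward (relᵣ P (evalₜₛ M ts a)) (q<q+ε (0<val ε))
      (subst (λ b → p ℚ.+ val ε ∈ lower (relᵣ P b)) (evalₜₛ-ι ts a (ηR P ε)) p∈)) ,
    λ {p} p∈ →
      let q , p<q , q∈ = rounded (relᵣ P (evalₜₛ M ts a)) p∈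
          ε , 2ε<q-p = halve (0<q-p p<q)
      in ε , subst (λ b → p ℚ.+ val ε ∈ lower (relᵣ P b)) (sym (evalₜₛ-ι ts a (ηR P ε)))
           (downward (relᵣ P (evalₜₛ M ts a))
             (<-by (ℚₚ.<-trans (q<q+ε {val ε} (0<val ε)) 2ε<q-p)
               (solve 3 (λ p q e → p :+ e :+ (q :- p) := q :+ e) refl p q (val ε)))
             q∈)
  eval-ι (const q) _ a = ≃-refl (fromℚ (ℚ[0,1].value q))
  eval-ι (φ ⇒ ψ) ∈L a =
    let φ≤ , φ≥ = eval-ι φ (⇒-subˡ ∈L) a
        ψ≤ , ψ≥ = eval-ι ψ (⇒-subʳ ∈L) a
        x = eval completion φ (ιs a) ; x′ = eval M φ a
        y = eval completion ψ (ιs a) ; y′ = eval M ψ a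
    in ⇒-mono x x′ y y′ φ≥ ψ≤ , ⇒-mono x′ x y′ y φ≤ ψ≥
  eval-ι {n} (sup φ) ∈L a = to , λ (x , p∈) → ι x , proj₂ (eval-ι φ φ∈L (x ∷ a)) p∈
    where
    φ∈L = sup-sub ∈L
    to : ∀ {p} → p ∈ lower (real (eval completion (sup φ) (ιs a))) →
         p ∈ lower (real (eval M (sup φ) a))
    to {p} (X , p∈) =
      let q , p<q , q∈ = rounded (real (eval completion φ (X ∷ ιs a))) p∈
          κ = q ℚ.- p
          δ , (r₀ , r₀∈δ , r₀≮0) , close =
            L-continuous φ∈L completion (X ∷ ιs a) (fromℚ κ)
              (0ℚ , 0<q-p p<q , ℚₚ.<-irrefl refl)
          r , r₀<r , r∈δ = rounded δ r₀∈δ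
          -- The point `X η` is within η of X, and η < r < δ.
          η , 2η<r = halve (ℚₚ.≤-<-trans (ℚₚ.≮⇒≥ r₀≮0) r₀<r)
          x = at X η
          η≤r = ℚₚ.<⇒≤ (ℚₚ.<-trans (q<q+ε {val η} (0<val η)) 2η<r)
          0≤r = ℚₚ.≤-trans (ℚₚ.<⇒≤ (0<val η)) η≤r
          s , s<κ , s∉ = close (ι x ∷ ιs a) (r , r∈δ ,
            [ ∉-upward (M̄.d X (ι x)) η≤r (d̄-at X η) , X̄.dⁿ-refl-∉ (ιs a) 0≤r ]′)
          fX = real (eval completion φ (X ∷ ιs a))
          fx = real (eval completion φ (ι x ∷ ιs a))
      in x , proj₁ (eval-ι φ φ∈L (x ∷ a)) (∣-∣≤-elimˡ fX fx {κ} {p}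
           (λ t∈ → ℚₚ.<-trans (∈-∉⇒< ∣ fX - fx ∣ t∈ s∉) s<κ)
           (subst (_∈ lower fX) (solve 2 (λ p q → q := p :+ (q :- p)) refl p q) q∈))
  eval-ι (supω φ) ∈L a =
    (λ (i , p∈) → i , proj₁ (eval-ι (φ i) (supω-sub ∈L i) a) p∈) ,
    (λ (i , p∈) → i , proj₂ (eval-ι (φ i) (supω-sub ∈L i) a) p∈)

  completion-models : ∀ {n} {φ : Formula S n} → φ ∈ L n → ∀ a →
                      M ⊨ φ at a → completion ⊨ φ at ιs a
  completion-models {φ = φ} φ∈L a (_ , 1≤φ) =
    ≃1 (eval completion φ (ιs a)) λ p<1 → proj₂ (eval-ι φ φ∈L a) (1≤φ p<1)

-- Omission in the completion

module _ {S : Signature} (L : (n : ℕ) → Pred (Formula S n) 0ℓ) (L-fragment : IsFragment L) where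
  open IsFragment L-fragment

  sups-∈ : ∀ m {n} {φ : Formula S (m ℕ.+ n)} → φ ∈ L (m ℕ.+ n) → sups m φ ∈ L n
  sups-∈ zero    φ∈L = φ∈L
  sups-∈ (suc m) φ∈L = sups-∈ m (sup-∈ φ∈L)

  ∧-∈ : ∀ {n} {φ ψ : Formula S n} → φ ∈ L n → ψ ∈ L n → (φ ∧ ψ) ∈ L n
  ∧-∈ φ∈L ψ∈L = ~-∈ (⇒-∈ (⇒-∈ (~-∈ φ∈L) (~-∈ ψ∈L)) (~-∈ ψ∈L))

  near-∈ : ∀ δ {n} {σ : Formula S n} → σ ∈ L n → near δ σ ∈ L n
  near-∈ δ {n} {σ} σ∈L = sups-∈ n (go (List.allFin n))
    where
    go : ∀ is → List.foldr _∧_ (σ [ vars (_↑ˡ n) ])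
                  (List.map (λ i → dist (var (n ↑ʳ i)) (var (i ↑ˡ n)) ⇒ const (closed δ)) is)
                ∈ L (n ℕ.+ n)
    go []       = []-∈ (vars (_↑ˡ n)) σ∈L
    go (i ∷ is) = ∧-∈ (⇒-∈ (dist-∈ _ _) (const-∈ (closed δ))) (go is)

module CompletionOmits (em : ∀ ℓ → ExcludedMiddle ℓ) {S : Signature} (M : Structure S)
  (L : (n : ℕ) → Pred (Formula S n) 0ℓ) (L-fragment : IsFragment L)
  (L-continuous : IsContinuous L) where

  open Completion em M
  open CompletionEval em M L L-fragment L-continuous
  open Substitution completion using (near-top)
  private module M̄ = Structure completion

  completion-omits : ∀ δ {n} {Φ : Pred (Formula S n) 0ℓ} → Φ ⊆ L n →
                     Omits M (Φ ^ δ) → Omits completion Φ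
  -- By regularity the approximations at level δ lie within δ of Xs, and Xs then witnesses the
  -- suprema in `near δ σ`.
  completion-omits δ {n} {Φ} Φ⊆L omits Xs realizes = omits (ats Xs δ) λ
    { (σ , σ∈Φ , refl) →
      ≃1 (eval M (near δ σ) (ats Xs δ)) λ p<1 →
        proj₁ (eval-ι (near δ σ) (near-∈ L L-fragment δ (Φ⊆L σ∈Φ)) (ats Xs δ))
          (near-top δ σ Xs (ιs (ats Xs δ)) close (proj₂ (realizes σ∈Φ)) p<1) }
    where
    close : ∀ i → val δ ∉ lower (M̄.d (lookup (ιs (ats Xs δ)) i) (lookup Xs i))
    close i = subst (λ X → val δ ∉ lower (M̄.d X (lookup Xs i)))
      (sym (trans (Vecₚ.lookup-map i ι (ats Xs δ))
                  (cong ι (Vecₚ.lookup-map i (λ X → Regular.at X δ) Xs))))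
      (d̄-at′ (lookup Xs i) δ)

theorem4p14 : (∀ ℓ → ExcludedMiddle ℓ) →
    (S : Signature) →
    (L : (n : ℕ) → Pred (Formula S n) 0ℓ) →
    IsFragment L → IsCountable L → IsContinuous L →
    (T : Pred (Formula S 0) 0ℓ) → IsTheory L T → Satisfiable T →
    (k : ℕ → ℕ) (Φ : (n : ℕ) → Pred (Formula S (k n)) 0ℓ) →
    (∀ n → IsType L T (Φ n)) →
    (∀ n → ¬ MetricallyPrincipal L T (Φ n)) →
    Σ[ M ∈ Structure S ]
    M ⊨* T × Structure.Complete M × (∀ n → Omits M (Φ n))
theorem4p14 em S L frag countable continuous T T⊆L satisfiable k Φ types nonprincipal =
  completion ,
  (λ σ∈T → completion-models (T⊆L σ∈T) [] (termModel-models T⊆L σ∈T)) ,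
  complete ,
  λ n → completion-omits (δ n) (Φ⊆L n) (termModel-omits n)
  where
  open Classical em using (dne)
  Φ⊆L : ∀ n → Φ n ⊆ L (k n)
  Φ⊆L n = proj₁ (types n)
  -- Excluded middle decides arbitrary types, so eliminating the double negation returns the pair
  -- and hence a choice of δ for every n.
  choice : ∀ n → ∃[ δ ] ¬ Principal L T (Φ n ^ δ)
  choice n = dne λ ¬∃ → nonprincipal n λ δ → dne λ ¬principal → ¬∃ (δ , ¬principal)
  δ : ℕ → ℚ⟨0,1⟩
  δ n = proj₁ (choice n)
  Ψ : ∀ n → Pred (Formula S (k n)) 0ℓ
  Ψ n = Φ n ^ δ n
  Ψ⊆L : ∀ n → Ψ n ⊆ L (k n)
  Ψ⊆L n (σ , σ∈Φ , refl) = near-∈ L frag (δ n) (Φ⊆L n σ∈Φ)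
  Ψ-nonprincipal : ∀ n → ¬ Principal L T (Ψ n)
  Ψ-nonprincipal n = proj₂ (choice n)
  open Generic em L frag countable T satisfiable k Ψ Ψ⊆L Ψ-nonprincipal
  open Completion em termModel
  open CompletionEval em termModel L frag continuous
  open CompletionOmits em termModel L frag continuous
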